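{- Let $\varepsilon=2^{ -j}$ ($j$ a positive integer) be a constant lower bound on all item sizes. The online algorithm described in the context produces, on every instance $I$, a packing $P$ with $P(I)\le 3\,\mathrm{OPT}(I)+O(\log(1/\varepsilon))$ and $P_c(I)\le 1.7\,\mathrm{OPT}(I_c)+O(\log(1/\varepsilon))$ for every colour $c$; thus it is a $(3,1.7)$-approximation algorithm. Moreover, it uses space at most $O(m)$ (at most $O(m)$ bins are open at any time), where $m$ is the number of colours.
   Context: Online coloured bin packing: items arrive one by one, each with a size $s(e)\in[\varepsilon,1]$ and a colour $c(e)\in\{1,\dots,m\}$, and must be placed irrevocably into unit-capacity bins. $I_c$ is the set of items of colour $c$; $\mathrm{OPT}(I)$, $\mathrm{OPT}(I_c)$ are the offline minimum numbers of bins to pack $I$, $I_c$; $P(I)$ is the number of bins of the packing and $P_c(I)$ the number of bins containing an item of colour $c$. For $i=1,\dots,j$, a level-$i$ bin is divided into exactly $1/(2^i\varepsilon)$ regions, each of size $2^i\varepsilon$ (level-$i$ regions); each region contains items of at most one colour. Modified Next Fit (MNF) packs an item $e$ of colour $c$: let $i$ be the highest level at which an item of colour $c$ is packed ($i=1$ if $e$ is the first item of colour $c$); if $e$ fits in colour $c$'s level-$i$ region, pack it there; otherwise let $l>i$ be the lowest level with $2^l\varepsilon\ge s(e)$ and pack $e$ into a new level-$l$ region (creating a new level-$l$ bin if no unused level-$l$ region exists). A colour has level $i$ if $i$ is the largest level of a bin containing items of that colour. The algorithm: an item of colour $c$ is packed with MNF into these non-isolated bins if colour $c$ has level $<j$;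 otherwise it is packed with Bounded Best-Fit (at most 2 open bins; an item goes into the fullest open bin with room, otherwise the fullest open bin is closed and a new bin opened) into isolated bins containing only items of colour $c$ (the last level-$j$ bin of colour $c$ is also considered isolated).
   Formalization: The item sizes s(e) in [ε,1] are taken to be rational numbers rather than arbitrary real numbers. -}

module Defs where

open import Data.Bool using (Bool; true; false; if_then_else_; _∧_; not)
open import Data.Nat as ℕ using (ℕ; zero; suc; _∸_; _^_; _⊔_)
open import Data.Fin using (Fin; _≟_)
open import Data.Product using (Σ; _×_; _,_; proj₁)
open import Data.List using (List; []; _∷_; _++_; length; lookup; map; foldr; filter; allFin)
open import Data.Bool.ListAction using (any)
open import Data.List.Relation.Unary.All using (All)
open import Data.List.Relation.Unary.Any using (Any)
open import Data.Integer using (+_)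
open import Data.Rational using (ℚ; 0ℚ; 1ℚ; ½; _+_; _*_; _/_; _≤_; _<_)
open import Relation.Nullary using (¬_; does)
open import Relation.Binary.PropositionalEquality using (_≡_)

eps : ℕ → ℚ
eps zero    = 1ℚ
eps (suc j) = ½ * eps j

pow2 : ℕ → ℚ
pow2 l = + (2 ^ l) / 1

regionSize : ℕ → ℕ → ℚ
regionSize j l = pow2 l * eps j

-- number of regions in a level-l bin: 1/(2^l ε) = 2^(j-l)
regionsPerBin : ℕ → ℕ → ℕ
regionsPerBin j l = 2 ^ (j ∸ l)

sumℚ : List ℚ → ℚ
sumℚ = foldr _+_ 0ℚ

record Item (m : ℕ) : Set where
  constructor item
  field
    size   : ℚ
    colour : Fin m
open Item public

ValidInstance : ∀ {m} → ℕ → List (Item m) → Set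
ValidInstance j I = All (λ e → (eps j ≤ size e) × (size e ≤ 1ℚ)) I

colourClass : ∀ {m} → Fin m → List (Item m) → List (Item m)
colourClass c I = filter (λ e → colour e ≟ c) I

binLoad : ∀ {m k} (I : List (Item m)) → (Fin (length I) → Fin k) → Fin k → ℚ
binLoad I f b =
  sumℚ (map (λ i → if does (f i ≟ b) then size (lookup I i) else 0ℚ) (allFin (length I)))

Packable : ∀ {m} → ℕ → List (Item m) → Set
Packable k I = Σ (Fin (length I) → Fin k) λ f → ∀ b → binLoad I f b ≤ 1ℚ

OPT : ∀ {m} → List (Item m) → ℕ → Set
OPT I k = Packable k I × (∀ k' → Packable k' I → k ℕ.≤ k')

-- A non-isolated bin of level l records its used level-l regions,
-- each with its colour and its load; the remaining
-- regionsPerBin j l - length regions regions are unused.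
-- An isolated bin records its colour, load and whether it is still open
-- for Bounded Best-Fit.
data Bin (m : ℕ) : Set where
  nonIso : (lvl : ℕ) (regions : List (Fin m × ℚ)) → Bin m
  iso    : (c : Fin m) (load : ℚ) (isOpen : Bool) → Bin m

containsᵇ : ∀ {m} → Fin m → Bin m → Bool
containsᵇ c (nonIso l rs) = any (λ r → does (proj₁ r ≟ c)) rs
containsᵇ c (iso c' _ _)  = does (c' ≟ c)

-- c has an isolated bin (i.e. c has reached level j)
isIsoᵇ : ∀ {m} → Fin m → List (Bin m) → Bool
isIsoᵇ c []                  = false
isIsoᵇ c (nonIso _ _ ∷ bs)   = isIsoᵇ c bs
isIsoᵇ c (iso c' _ _ ∷ bs)   = if does (c' ≟ c) then true else isIsoᵇ c bs

-- level of colour c among non-isolated bins (0 if c has no item there)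
levelOf : ∀ {m} → Fin m → List (Bin m) → ℕ
levelOf c []                  = 0
levelOf c (nonIso l rs ∷ bs)  = (if containsᵇ c (nonIso l rs) then l else 0) ⊔ levelOf c bs
levelOf c (iso _ _ _ ∷ bs)    = levelOf c bs

openIsoCount : ∀ {m} → Fin m → List (Bin m) → ℕ
openIsoCount c []                    = 0
openIsoCount c (nonIso _ _ ∷ bs)     = openIsoCount c bs
openIsoCount c (iso c' _ true ∷ bs)  = (if does (c' ≟ c) then 1 else 0) ℕ.+ openIsoCount c bs
openIsoCount c (iso c' _ false ∷ bs) = openIsoCount c bs

HasFreeRegion : ∀ {m} → ℕ → ℕ → Bin m → Set
HasFreeRegion j l (nonIso l' rs) = (l' ≡ l) × (length rs ℕ.< regionsPerBin j l)
HasFreeRegion j l (iso _ _ _)    = Data.Empty.⊥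
  where import Data.Empty

LeastLevel : ℕ → ℕ → ℚ → ℕ → Set
LeastLevel j lo s l =
  (lo ℕ.≤ l) × (s ≤ regionSize j l) × (∀ l' → lo ℕ.≤ l' → l' ℕ.< l → regionSize j l' < s)

data PlaceNew {m : ℕ} (j : ℕ) (c : Fin m) (s : ℚ) (l : ℕ) : List (Bin m) → List (Bin m) → Set where
  existing : ∀ pre rs post → l ℕ.< j → length rs ℕ.< regionsPerBin j l →
    PlaceNew j c s l (pre ++ nonIso l rs ∷ post) (pre ++ nonIso l ((c , s) ∷ rs) ∷ post)
  fresh : ∀ bs → l ℕ.< j → All (λ b → ¬ HasFreeRegion j l b) bs →
    PlaceNew j c s l bs (bs ++ nonIso l ((c , s) ∷ []) ∷ [])
  -- a new level-j bin (a single region) is the colour's isolated open bin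
  top : ∀ bs → l ≡ j →
    PlaceNew j c s l bs (bs ++ iso c s true ∷ [])

data MNFStep {m : ℕ} (j : ℕ) (c : Fin m) (s : ℚ) : List (Bin m) → List (Bin m) → Set where
  fits : ∀ i pre rpre ℓ rpost post →
    levelOf c (pre ++ nonIso i (rpre ++ (c , ℓ) ∷ rpost) ∷ post) ≡ i →
    ℓ + s ≤ regionSize j i →
    MNFStep j c s (pre ++ nonIso i (rpre ++ (c , ℓ) ∷ rpost) ∷ post)
                  (pre ++ nonIso i (rpre ++ (c , ℓ + s) ∷ rpost) ∷ post)
  moveUp : ∀ i pre rpre ℓ rpost post l bs' →
    levelOf c (pre ++ nonIso i (rpre ++ (c , ℓ) ∷ rpost) ∷ post) ≡ i →
    ¬ (ℓ + s ≤ regionSize j i) →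
    LeastLevel j (suc i) s l →
    PlaceNew j c s l (pre ++ nonIso i (rpre ++ (c , ℓ) ∷ rpost) ∷ post) bs' →
    MNFStep j c s (pre ++ nonIso i (rpre ++ (c , ℓ) ∷ rpost) ∷ post) bs'
  -- first item of colour c (level taken to be 1)
  first : ∀ bs l bs' →
    levelOf c bs ≡ 0 →
    LeastLevel j 1 s l →
    PlaceNew j c s l bs bs' →
    MNFStep j c s bs bs'

NotFullerFitting : ∀ {m} → Fin m → ℚ → ℚ → Bin m → Set
NotFullerFitting c s ℓ b = ∀ ℓ' → b ≡ iso c ℓ' true → ℓ' + s ≤ 1ℚ → ℓ' ≤ ℓ

NotFuller : ∀ {m} → Fin m → ℚ → Bin m → Set
NotFuller c ℓ b = ∀ ℓ' → b ≡ iso c ℓ' true → ℓ' ≤ ℓ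

NoRoom : ∀ {m} → Fin m → ℚ → Bin m → Set
NoRoom c s b = ∀ ℓ' → b ≡ iso c ℓ' true → ¬ (ℓ' + s ≤ 1ℚ)

data BBFStep {m : ℕ} (c : Fin m) (s : ℚ) : List (Bin m) → List (Bin m) → Set where
  bestFit : ∀ pre ℓ post →
    ℓ + s ≤ 1ℚ →
    All (NotFullerFitting c s ℓ) (pre ++ post) →
    BBFStep c s (pre ++ iso c ℓ true ∷ post) (pre ++ iso c (ℓ + s) true ∷ post)
  openNew : ∀ bs →
    All (NoRoom c s) bs →
    openIsoCount c bs ℕ.< 2 →
    BBFStep c s bs (bs ++ iso c s true ∷ [])
  closeAndOpen : ∀ pre ℓ post →
    All (NoRoom c s) (pre ++ iso c ℓ true ∷ post) →
    openIsoCount c (pre ++ iso c ℓ true ∷ post) ℕ.≥ 2 →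
    All (NotFuller c ℓ) (pre ++ post) →
    BBFStep c s (pre ++ iso c ℓ true ∷ post) (pre ++ iso c ℓ false ∷ post ++ iso c s true ∷ [])

data Step {m : ℕ} (j : ℕ) : List (Bin m) → Item m → List (Bin m) → Set where
  viaMNF : ∀ {bs bs'} (e : Item m) → isIsoᵇ (colour e) bs ≡ false →
    MNFStep j (colour e) (size e) bs bs' → Step j bs e bs'
  viaBBF : ∀ {bs bs'} (e : Item m) → isIsoᵇ (colour e) bs ≡ true →
    BBFStep (colour e) (size e) bs bs' → Step j bs e bs'

data Run {m : ℕ} (j : ℕ) : List (Bin m) → List (Item m) → List (Bin m) → Set where
  done : ∀ bs → Run j bs [] bs
  step : ∀ {bs bs' bs''} e I → Step j bs e bs' → Run j bs' I bs'' → Run j bs (e ∷ I) bs''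

totalBins : ∀ {m} → List (Bin m) → ℕ
totalBins = length

binsWithColour : ∀ {m} → Fin m → List (Bin m) → ℕ
binsWithColour c bs = length (filter (λ b → Data.Bool.T? (containsᵇ c b)) bs)
  where import Data.Bool

-- a bin is open if it can still receive items:
--   isolated bins flagged open;
--   non-isolated bins with an unused region, or containing the current region
--   of a colour still packed by MNF (its level equals the bin's level)
isOpenᵇ : ∀ {m} → ℕ → List (Bin m) → Bin m → Bool
isOpenᵇ j bs (iso _ _ o) = o
isOpenᵇ j bs (nonIso l rs) =
  does (ℕ.suc (length rs) ℕ.≤? regionsPerBin j l)
  Data.Bool.∨ any (λ r → not (isIsoᵇ (proj₁ r) bs) ∧ does (levelOf (proj₁ r) bs ℕ.≟ l)) rs
  where import Data.Bool

openBins : ∀ {m} → ℕ → List (Bin m) → ℕ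
openBins j bs = length (filter (λ b → Data.Bool.T? (isOpenᵇ j bs b)) bs)
  where import Data.Bool

{-# OPTIONS --safe #-}

-- The capacity of the regions reserved for one colour is at most three times their content: if an item
-- does not fit into the region of level i and moves to level i + 1, it and the content of that region
-- exceed 2^i ε and cover both, and if it skips a level, then it fills more than half of its new region.
-- In the isolated bins of a colour every closed bin is more than half full and any two open bins
-- together exceed 1. Since at most one non-isolated bin per level has unused regions, the factor 3 follows.
--
-- For the factor 1.7, an item x has the First Fit weight 6/5 x + bonus(x). A bin of capacity 1 holds
-- weight at most 17/10, and Bounded Best-Fit packs weight at least 1 per bin on average: the bonus of
-- the newer of two open bins compensates the deficit of the bin that is closed.
module Submission where

open import Defs
open import Data.Bool using (Bool; true; false; if_then_else_; T; T?; _∧_; _∨_)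
open import Data.Bool.ListAction using (any)
open import Data.Bool.Properties using (T-∧)
open import Data.Empty using (⊥; ⊥-elim)
open import Data.Fin using (Fin; zero; suc; _≟_)
open import Data.Integer as ℤ using (ℤ; -[1+_]) renaming (+_ to pos)
import Data.Integer.Properties as ℤ
open import Data.List using (List; []; _∷_; [_]; _++_; allFin; concatMap; filter; length; lookup; map)
open import Data.List.Membership.Propositional.Properties using (∈-lookup)
open import Data.List.Properties
  using (∷-injective; ++-assoc; ++-identityʳ; concatMap-++; length-++; length-++-sucʳ;
    map-++; map-id; map-tabulate; map-∘; tabulate-lookup)
open import Data.List.Relation.Unary.All as All using (All; []; _∷_)
import Data.List.Relation.Unary.All.Properties as All
open import Data.Nat as ℕ using (ℕ; zero; suc; _∸_; _^_)
open import Data.Nat.ListAction using (sum)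
open import Data.Nat.ListAction.Properties using (sum-++)
import Data.Nat.Properties as ℕ
open import Algebra.Properties.CommutativeSemigroup ℕ.+-commutativeSemigroup using (interchange)
open import Data.Product using (Σ; ∃-syntax; _×_; _,_; proj₁; proj₂)
open import Data.Rational using (ℚ; 0ℚ; 1ℚ; ½; _+_; _*_; -_; _-_; _/_; _≤_; _<_; nonNegative; positive)
open import Data.Rational.Properties hiding (_≟_)
open import Data.Rational.Solver using (module +-*-Solver)
import Data.Rational.Unnormalised as ℚᵘ
import Data.Rational.Unnormalised.Properties as ℚᵘ
open import Data.Sum using (_⊎_; inj₁; inj₂)
open import Data.Vec using (Vec; []; _∷_; tabulate)
import Data.Vec as Vec
open import Data.Vec.N-ary using (N-ary; _$ⁿ_)
open import Function using (_∘_)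
open import Function.Bundles using (Equivalence)
open import Relation.Binary.PropositionalEquality hiding ([_])
open import Relation.Nullary using (Dec; yes; no; ¬_; does)
open import Relation.Nullary.Decidable using (dec-true; dec-false)

-- Linear arithmetic over ℚ by Fourier–Motzkin elimination

-- In units of a tenth, a closed bin must be paid 10 and its load p yields 12p, so only loads below
-- 5/6 leave a deficit. An item that does not fit beside p has bonus at least 5 - 6p if p is at
-- least 2/3, so two such items cover the deficit; if p is smaller, both exceed 1/3, and the bin
-- that holds them pays for itself. The obstacle is that the older bin may be closed while the newer
-- one still holds a single item of size at most 1/2, whose bonus alone is too small. The payment of
-- a whole bin is then borrowed. No second loan can arise before the first is repaid: the remaining
-- bin is at most half full and never the fuller one, and each item that opens a bin meanwhile
-- exceeds 1/2. The loan costs only an additive constant. Regions and isolated bins have one colour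
-- each, so a step changes the view of its own colour only, and both amortisations run colour by
-- colour. Both additive logarithms count levels: one region per colour and level, and one partly
-- used bin per level.

fromℤ : ℤ → ℚ
fromℤ z = z / 1

ι : ℕ → ℚ
ι n = fromℤ (pos n)

fromℤ-+ : ∀ a b → fromℤ (a ℤ.+ b) ≡ fromℤ a + fromℤ b
fromℤ-+ a b = toℚᵘ-injective (ℚᵘ.≃-trans (toℚᵘ-fromℚᵘ (ℚᵘ.mkℚᵘ (a ℤ.+ b) 0)) (ℚᵘ.≃-sym
  (ℚᵘ.≃-trans (toℚᵘ-homo-+ (fromℤ a) (fromℤ b))
  (ℚᵘ.≃-trans (ℚᵘ.+-cong (toℚᵘ-fromℚᵘ (ℚᵘ.mkℚᵘ a 0)) (toℚᵘ-fromℚᵘ (ℚᵘ.mkℚᵘ b 0)))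
    (ℚᵘ.*≡* (cong₂ ℤ._*_ (cong₂ ℤ._+_ (ℤ.*-identityʳ a) (ℤ.*-identityʳ b)) refl))))))

fromℤ-* : ∀ a b → fromℤ (a ℤ.* b) ≡ fromℤ a * fromℤ b
fromℤ-* a b = toℚᵘ-injective (ℚᵘ.≃-trans (toℚᵘ-fromℚᵘ (ℚᵘ.mkℚᵘ (a ℤ.* b) 0)) (ℚᵘ.≃-sym
  (ℚᵘ.≃-trans (toℚᵘ-homo-* (fromℤ a) (fromℤ b))
    (ℚᵘ.*-cong (toℚᵘ-fromℚᵘ (ℚᵘ.mkℚᵘ a 0)) (toℚᵘ-fromℚᵘ (ℚᵘ.mkℚᵘ b 0))))))

fromℤ-neg : ∀ a → fromℤ (ℤ.- a) ≡ - fromℤ a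
fromℤ-neg a = trans (sym (+-identityʳ _)) (trans (cong (fromℤ (ℤ.- a) +_) (sym (+-inverseʳ (fromℤ a))))
  (trans (sym (+-assoc (fromℤ (ℤ.- a)) _ _)) (trans (cong (_+ - fromℤ a)
    (trans (sym (fromℤ-+ (ℤ.- a) a)) (cong fromℤ (ℤ.+-inverseˡ a)))) (+-identityˡ _))))

fromℤ-mono-≤ : ∀ {a b} → a ℤ.≤ b → fromℤ a ≤ fromℤ b
fromℤ-mono-≤ {a} {b} a≤b = toℚᵘ-cancel-≤ (ℚᵘ.≤-respʳ-≃ (ℚᵘ.≃-sym (toℚᵘ-fromℚᵘ (ℚᵘ.mkℚᵘ b 0)))
  (ℚᵘ.≤-respˡ-≃ (ℚᵘ.≃-sym (toℚᵘ-fromℚᵘ (ℚᵘ.mkℚᵘ a 0)))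
    (ℚᵘ.*≤* (subst₂ ℤ._≤_ (sym (ℤ.*-identityʳ a)) (sym (ℤ.*-identityʳ b)) a≤b))))

fromℤ-mono-< : ∀ {a b} → a ℤ.< b → fromℤ a < fromℤ b
fromℤ-mono-< {a} {b} a<b = toℚᵘ-cancel-< (ℚᵘ.<-respʳ-≃ (ℚᵘ.≃-sym (toℚᵘ-fromℚᵘ (ℚᵘ.mkℚᵘ b 0)))
  (ℚᵘ.<-respˡ-≃ (ℚᵘ.≃-sym (toℚᵘ-fromℚᵘ (ℚᵘ.mkℚᵘ a 0)))
    (ℚᵘ.*<* (subst₂ ℤ._<_ (sym (ℤ.*-identityʳ a)) (sym (ℤ.*-identityʳ b)) a<b))))

data Form : ℕ → Set where
  con : ℤ → Form 0
  _∙_ : ∀ {n} → ℤ → Form n → Form (suc n)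

⟦_⟧ : ∀ {n} → Form n → Vec ℚ n → ℚ
⟦ con d ⟧ []      = fromℤ d
⟦ a ∙ f ⟧ (x ∷ ρ) = fromℤ a * x + ⟦ f ⟧ ρ

constF : ∀ {n} → ℤ → Form n
constF {zero}  d = con d
constF {suc n} d = pos 0 ∙ constF d

varF : ∀ {n} → Fin n → Form n
varF zero    = pos 1 ∙ constF (pos 0)
varF (suc i) = pos 0 ∙ varF i

addF : ∀ {n} → Form n → Form n → Form n
addF (con c) (con d) = con (c ℤ.+ d)
addF (a ∙ f) (b ∙ g) = (a ℤ.+ b) ∙ addF f g

scaleF : ∀ {n} → ℤ → Form n → Form n
scaleF k (con d) = con (k ℤ.* d)
scaleF k (a ∙ f) = (k ℤ.* a) ∙ scaleF k f

subF : ∀ {n} → Form n → Form n → Form n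
subF f g = addF f (scaleF (ℤ.- (pos 1)) g)

open +-*-Solver using (solve; _:+_; _:*_; :-_; _:=_)

constF-sound : ∀ {n} d (ρ : Vec ℚ n) → ⟦ constF d ⟧ ρ ≡ fromℤ d
constF-sound d []      = refl
constF-sound d (x ∷ ρ) = trans (cong₂ _+_ (*-zeroˡ x) (constF-sound d ρ)) (+-identityˡ _)

varF-sound : ∀ {n} i (ρ : Vec ℚ n) → ⟦ varF i ⟧ ρ ≡ Vec.lookup ρ i
varF-sound zero    (x ∷ ρ) = trans (cong₂ _+_ (*-identityˡ x) (constF-sound (pos 0) ρ)) (+-identityʳ x)
varF-sound (suc i) (x ∷ ρ) = trans (cong₂ _+_ (*-zeroˡ x) (varF-sound i ρ)) (+-identityˡ _)

addF-sound : ∀ {n} (f g : Form n) ρ → ⟦ addF f g ⟧ ρ ≡ ⟦ f ⟧ ρ + ⟦ g ⟧ ρ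
addF-sound (con c) (con d) []      = fromℤ-+ c d
addF-sound (a ∙ f) (b ∙ g) (x ∷ ρ) rewrite fromℤ-+ a b | addF-sound f g ρ =
  solve 5 (λ a b x f g → (a :+ b) :* x :+ (f :+ g) := (a :* x :+ f) :+ (b :* x :+ g)) refl
    (fromℤ a) (fromℤ b) x (⟦ f ⟧ ρ) (⟦ g ⟧ ρ)

scaleF-sound : ∀ {n} k (f : Form n) ρ → ⟦ scaleF k f ⟧ ρ ≡ fromℤ k * ⟦ f ⟧ ρ
scaleF-sound k (con d) []      = fromℤ-* k d
scaleF-sound k (a ∙ f) (x ∷ ρ) rewrite fromℤ-* k a | scaleF-sound k f ρ =
  solve 4 (λ k a x f → (k :* a) :* x :+ k :* f := k :* (a :* x :+ f)) refl
    (fromℤ k) (fromℤ a) x (⟦ f ⟧ ρ)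

subF-sound : ∀ {n} (f g : Form n) ρ → ⟦ subF f g ⟧ ρ ≡ ⟦ f ⟧ ρ - ⟦ g ⟧ ρ
subF-sound f g ρ = trans (addF-sound f _ ρ) (cong (⟦ f ⟧ ρ +_)
  (trans (scaleF-sound (ℤ.- (pos 1)) g ρ) (trans (sym (neg-distribˡ-* 1ℚ (⟦ g ⟧ ρ))) (cong -_ (*-identityˡ _)))))

Row : ℕ → Set
Row n = Bool × Form n

Holds : ∀ {n} → Vec ℚ n → Row n → Set
Holds ρ (false , f) = 0ℚ ≤ ⟦ f ⟧ ρ
Holds ρ (true  , f) = 0ℚ < ⟦ f ⟧ ρ

weaken : ∀ {n} {ρ : Vec ℚ n} r → Holds ρ r → 0ℚ ≤ ⟦ proj₂ r ⟧ ρ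
weaken (false , f) h = h
weaken (true  , f) h = <⇒≤ h

free : ∀ {n} → Row (suc n) → List (Row n)
free (s , pos 0 ∙ f) = [ s , f ]
free _               = []

-- The first row bounds the eliminated variable from below, the second from above. Scaling each by
-- the absolute leading coefficient of the other makes the variable cancel, and the sum is strict as
-- soon as one row is.
resolve : ∀ {n} → Row (suc n) → Row (suc n) → List (Row n)
resolve (s , pos (suc a) ∙ f) (t , -[1+ b ] ∙ g) =
  [ s ∨ t , addF (scaleF (pos (suc b)) f) (scaleF (pos (suc a)) g) ]
resolve _ _ = []

eliminate : ∀ {n} → List (Row (suc n)) → List (Row n)
eliminate rs = concatMap free rs ++ concatMap (λ r → concatMap (resolve r) rs) rs

refute : ∀ n → List (Row n) → Bool
refute zero    = any λ where
  (_    , con -[1+ _ ]) → true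
  (true , con (pos 0))  → true
  _                     → false
refute (suc n) rs = refute n (eliminate rs)

concatMap-All : ∀ {A B : Set} {P : A → Set} {Q : B → Set} {f : A → List B} →
  (∀ a → P a → All Q (f a)) → ∀ {xs} → All P xs → All Q (concatMap f xs)
concatMap-All h []         = []
concatMap-All h (px ∷ pxs) = All.++⁺ (h _ px) (concatMap-All h pxs)

free-sound : ∀ {n} x (ρ : Vec ℚ n) r → Holds (x ∷ ρ) r → All (Holds ρ) (free r)
free-sound x ρ (false , pos 0       ∙ f) h = subst (0ℚ ≤_) (trans (cong (_+ ⟦ f ⟧ ρ) (*-zeroˡ x)) (+-identityˡ _)) h ∷ []
free-sound x ρ (true  , pos 0       ∙ f) h = subst (0ℚ <_) (trans (cong (_+ ⟦ f ⟧ ρ) (*-zeroˡ x)) (+-identityˡ _)) h ∷ []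
free-sound x ρ (s     , pos (suc _) ∙ f) h = []
free-sound x ρ (s     , -[1+ _ ]    ∙ f) h = []

private
  0<suc : ∀ n → 0ℚ < fromℤ (pos (suc n))
  0<suc n = fromℤ-mono-< {pos 0} {pos (suc n)} (ℤ.+<+ (ℕ.s≤s ℕ.z≤n))

  scale-≤ : ∀ n {x} → 0ℚ ≤ x → 0ℚ ≤ fromℤ (pos (suc n)) * x
  scale-≤ n {x} 0≤x = subst (_≤ fromℤ (pos (suc n)) * x) (*-zeroʳ (fromℤ (pos (suc n))))
    (*-monoˡ-≤-nonNeg (fromℤ (pos (suc n))) {{nonNegative (<⇒≤ (0<suc n))}} 0≤x)

  scale-< : ∀ n {x} → 0ℚ < x → 0ℚ < fromℤ (pos (suc n)) * x
  scale-< n {x} 0<x = subst (_< fromℤ (pos (suc n)) * x) (*-zeroʳ (fromℤ (pos (suc n))))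
    (*-monoʳ-<-pos (fromℤ (pos (suc n))) {{positive (0<suc n)}} 0<x)

resolve-sound : ∀ {n} x (ρ : Vec ℚ n) r r′ → Holds (x ∷ ρ) r → Holds (x ∷ ρ) r′ → All (Holds ρ) (resolve r r′)
resolve-sound x ρ (s , pos (suc a) ∙ f) (t , -[1+ b ] ∙ g) h h′ = combine s t h h′ ∷ []
  where
  A B F G : ℚ
  A = fromℤ (pos (suc a))
  B = fromℤ (pos (suc b))
  F = A * x + ⟦ f ⟧ ρ
  G = fromℤ -[1+ b ] * x + ⟦ g ⟧ ρ
  value : ⟦ addF (scaleF (pos (suc b)) f) (scaleF (pos (suc a)) g) ⟧ ρ ≡ B * F + A * G
  value rewrite addF-sound (scaleF (pos (suc b)) f) (scaleF (pos (suc a)) g) ρ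
    | scaleF-sound (pos (suc b)) f ρ | scaleF-sound (pos (suc a)) g ρ | fromℤ-neg (pos (suc b)) =
    solve 5 (λ a b x f g → b :* f :+ a :* g := b :* (a :* x :+ f) :+ a :* (:- b :* x :+ g)) refl
      A B x (⟦ f ⟧ ρ) (⟦ g ⟧ ρ)
  combine : ∀ s t → Holds (x ∷ ρ) (s , pos (suc a) ∙ f) → Holds (x ∷ ρ) (t , -[1+ b ] ∙ g) →
    Holds ρ (s ∨ t , addF (scaleF (pos (suc b)) f) (scaleF (pos (suc a)) g))
  combine false false h h′ = subst (0ℚ ≤_) (sym value) (+-mono-≤ (scale-≤ b h) (scale-≤ a h′))
  combine false true  h h′ = subst (0ℚ <_) (sym value) (+-mono-≤-< (scale-≤ b h) (scale-< a h′))
  combine true  false h h′ = subst (0ℚ <_) (sym value) (+-mono-<-≤ (scale-< b h) (scale-≤ a h′))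
  combine true  true  h h′ = subst (0ℚ <_) (sym value) (+-mono-<-≤ (scale-< b h) (scale-≤ a (<⇒≤ h′)))
resolve-sound x ρ (s , pos (suc a) ∙ f) (t , pos b ∙ g)   h h′ = []
resolve-sound x ρ (s , pos 0       ∙ f) (t , b ∙ g)       h h′ = []
resolve-sound x ρ (s , -[1+ a ]    ∙ f) (t , b ∙ g)       h h′ = []

eliminate-sound : ∀ {n} x (ρ : Vec ℚ n) {rs} → All (Holds (x ∷ ρ)) rs → All (Holds ρ) (eliminate rs)
eliminate-sound x ρ hs = All.++⁺ (concatMap-All (free-sound x ρ) hs)
  (concatMap-All (λ r h → concatMap-All (λ r′ → resolve-sound x ρ r r′ h) hs) hs)

refute-sound : ∀ n (ρ : Vec ℚ n) rs → T (refute n rs) → All (Holds ρ) rs → ⊥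
refute-sound (suc n) (x ∷ ρ) rs t hs = refute-sound n ρ (eliminate rs) t (eliminate-sound x ρ hs)
refute-sound zero [] ((s     , con -[1+ d ]) ∷ rs) t (h ∷ hs) =
  <-irrefl refl (≤-<-trans (weaken (s , con -[1+ d ]) h) (fromℤ-mono-< { -[1+ d ]} {pos 0} ℤ.-<+))
refute-sound zero [] ((true  , con (pos 0))     ∷ rs) t (h ∷ hs) = <-irrefl refl h
refute-sound zero [] ((true  , con (pos (suc d))) ∷ rs) t (h ∷ hs) = refute-sound zero [] rs t hs
refute-sound zero [] ((false , con (pos d))     ∷ rs) t (h ∷ hs) = refute-sound zero [] rs t hs

-- Reflection of linear sequents

infixl 7 _·_
infixl 6 _⊕_ _⊖_
infix  4 _≼_ _≺_ _≈_
infix  3 ⊢_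
infixr 2 _⇒_

data Expr (n : ℕ) : Set where
  var     : Fin n → Expr n
  #_      : ℕ → Expr n
  _·_     : ℕ → Expr n → Expr n
  _⊕_ _⊖_ : Expr n → Expr n → Expr n

data Atom (n : ℕ) : Set where
  _≼_ _≺_ _≈_ : Expr n → Expr n → Atom n

data Sequent (n : ℕ) : Set where
  ⊢_  : Atom n → Sequent n
  ⊢⊥  : Sequent n
  _⇒_ : Atom n → Sequent n → Sequent n

module _ {n : ℕ} where

  exprValue : Expr n → Vec ℚ n → ℚ
  exprValue (var i) ρ = Vec.lookup ρ i
  exprValue (# k)   ρ = ι k
  exprValue (k · e) ρ = ι k * exprValue e ρ
  exprValue (d ⊕ e) ρ = exprValue d ρ + exprValue e ρ
  exprValue (d ⊖ e) ρ = exprValue d ρ - exprValue e ρ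

  atomMeaning : Atom n → Vec ℚ n → Set
  atomMeaning (d ≼ e) ρ = exprValue d ρ ≤ exprValue e ρ
  atomMeaning (d ≺ e) ρ = exprValue d ρ < exprValue e ρ
  atomMeaning (d ≈ e) ρ = exprValue d ρ ≡ exprValue e ρ

  Meaning : Sequent n → Vec ℚ n → Set
  Meaning (⊢ a)   ρ = atomMeaning a ρ
  Meaning ⊢⊥      ρ = ⊥
  Meaning (a ⇒ S) ρ = atomMeaning a ρ → Meaning S ρ

  form : Expr n → Form n
  form (var i) = varF i
  form (# k)   = constF (pos k)
  form (k · e) = scaleF (pos k) (form e)
  form (d ⊕ e) = addF (form d) (form e)
  form (d ⊖ e) = subF (form d) (form e)

  form-sound : ∀ e ρ → ⟦ form e ⟧ ρ ≡ exprValue e ρ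
  form-sound (var i) ρ = varF-sound i ρ
  form-sound (# k)   ρ = constF-sound (pos k) ρ
  form-sound (k · e) ρ = trans (scaleF-sound (pos k) (form e) ρ) (cong (ι k *_) (form-sound e ρ))
  form-sound (d ⊕ e) ρ = trans (addF-sound (form d) (form e) ρ) (cong₂ _+_ (form-sound d ρ) (form-sound e ρ))
  form-sound (d ⊖ e) ρ = trans (subF-sound (form d) (form e) ρ) (cong₂ _-_ (form-sound d ρ) (form-sound e ρ))

  assume : Atom n → List (Row n) → List (Row n)
  assume (d ≼ e) rs = (false , subF (form e) (form d)) ∷ rs
  assume (d ≺ e) rs = (true  , subF (form e) (form d)) ∷ rs
  assume (d ≈ e) rs = (false , subF (form e) (form d)) ∷ (false , subF (form d) (form e)) ∷ rs

  provable : List (Row n) → Sequent n → Bool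
  provable rs (⊢ d ≼ e) = refute n (assume (e ≺ d) rs)
  provable rs (⊢ d ≺ e) = refute n (assume (e ≼ d) rs)
  provable rs (⊢ d ≈ e) = refute n (assume (e ≺ d) rs) ∧ refute n (assume (d ≺ e) rs)
  provable rs ⊢⊥        = refute n rs
  provable rs (a ⇒ S)   = provable (assume a rs) S

  private
    difference : ∀ d e ρ → ⟦ subF (form e) (form d) ⟧ ρ ≡ exprValue e ρ - exprValue d ρ
    difference d e ρ = trans (subF-sound (form e) (form d) ρ) (cong₂ _-_ (form-sound e ρ) (form-sound d ρ))

    row-≤ : ∀ d e ρ → exprValue d ρ ≤ exprValue e ρ → Holds ρ (false , subF (form e) (form d))
    row-≤ d e ρ h = subst₂ _≤_ (+-inverseʳ (exprValue d ρ)) (sym (difference d e ρ)) (+-monoˡ-≤ (- exprValue d ρ) h)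

    row-< : ∀ d e ρ → exprValue d ρ < exprValue e ρ → Holds ρ (true , subF (form e) (form d))
    row-< d e ρ h = subst₂ _<_ (+-inverseʳ (exprValue d ρ)) (sym (difference d e ρ)) (+-monoˡ-< (- exprValue d ρ) h)

  assume-sound : ∀ a {rs} ρ → atomMeaning a ρ → All (Holds ρ) rs → All (Holds ρ) (assume a rs)
  assume-sound (d ≼ e) ρ h hs = row-≤ d e ρ h ∷ hs
  assume-sound (d ≺ e) ρ h hs = row-< d e ρ h ∷ hs
  assume-sound (d ≈ e) ρ h hs = row-≤ d e ρ (≤-reflexive h) ∷ row-≤ e d ρ (≤-reflexive (sym h)) ∷ hs

  provable-sound : ∀ S {rs} ρ → T (provable rs S) → All (Holds ρ) rs → Meaning S ρ
  provable-sound (⊢ d ≼ e) ρ t hs = ≮⇒≥ λ h → refute-sound n ρ _ t (assume-sound (e ≺ d) ρ h hs)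
  provable-sound (⊢ d ≺ e) ρ t hs = ≰⇒> λ h → refute-sound n ρ _ t (assume-sound (e ≼ d) ρ h hs)
  provable-sound (⊢ d ≈ e) ρ t hs = ≤-antisym
    (≮⇒≥ λ h → refute-sound n ρ _ (proj₁ (Equivalence.to T-∧ t)) (assume-sound (e ≺ d) ρ h hs))
    (≮⇒≥ λ h → refute-sound n ρ _ (proj₂ (Equivalence.to T-∧ t)) (assume-sound (d ≺ e) ρ h hs))
  provable-sound ⊢⊥        ρ t hs = refute-sound n ρ _ t hs
  provable-sound (a ⇒ S)   ρ t hs h = provable-sound S ρ t (assume-sound a ρ h hs)

-- Proof by evaluation: for a concrete sequent `provable` computes to `true`, so the implicit
-- argument is filled in, and `Meaning` unfolds to the inequality wanted. Nonlinear terms such as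
-- `bonus x` enter as entries of `ρ` and are treated as atoms.
linear : ∀ {n} (ρ : Vec ℚ n) (S : N-ary n (Expr n) (Sequent n)) → let S′ = S $ⁿ tabulate var in
  {T (provable [] S′)} → Meaning S′ ρ
linear ρ S {t} = provable-sound (S $ⁿ tabulate var) ρ t []

-- The weight function

-- The bonus grows continuously from 0 at 1/6 to 1 at 1/3, stays there up to 1/2 and then jumps to
-- 4. Stated as a relation, a case split yields the value together with the range of `x`.
data Class (x : ℚ) : ℚ → Set where
  tiny   : ι 6 * x ≤ 1ℚ → Class x 0ℚ
  small  : 1ℚ < ι 6 * x → ι 3 * x ≤ 1ℚ → Class x (ι 6 * x - 1ℚ)
  medium : 1ℚ < ι 3 * x → ι 2 * x ≤ 1ℚ → Class x 1ℚ
  large  : 1ℚ < ι 2 * x → Class x (ι 4)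

classify : ∀ x → ∃[ b ] Class x b
classify x with ι 6 * x ≤? 1ℚ
... | yes t = _ , tiny t
... | no ¬t with ι 3 * x ≤? 1ℚ
...   | yes s = _ , small (≰⇒> ¬t) s
...   | no ¬s with ι 2 * x ≤? 1ℚ
...     | yes m = _ , medium (≰⇒> ¬s) m
...     | no ¬m = _ , large (≰⇒> ¬m)

-- All knowledge of `bonus` passes through `class`: a joint split on both replaces `bonus x` by its
-- formula, and elsewhere it remains an atom for `linear`.
abstract
  bonus : ℚ → ℚ
  bonus x = proj₁ (classify x)

  class : ∀ x → Class x (bonus x)
  class x = proj₂ (classify x)

-- Ten times the weight 6/5 x + bonus, so that all coefficients are integers.
weight : ℚ → ℚ
weight x = ι 12 * x + bonus x

bonus-≥0 : ∀ x → 0ℚ ≤ bonus x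
bonus-≥0 x with bonus x | class x
... | _ | tiny _     = ≤-refl
... | _ | small s _  = linear (x ∷ []) (λ x → # 1 ≺ 6 · x ⇒ ⊢ # 0 ≼ 6 · x ⊖ # 1) s
... | _ | medium _ _ = linear [] (⊢ # 0 ≼ # 1)
... | _ | large _    = linear [] (⊢ # 0 ≼ # 4)

bonus-third : ∀ x → 1ℚ < ι 3 * x → 1ℚ ≤ bonus x
bonus-third x h with bonus x | class x
... | _ | tiny t     = ⊥-elim (linear (x ∷ []) (λ x → # 1 ≺ 3 · x ⇒ 6 · x ≼ # 1 ⇒ ⊢⊥) h t)
... | _ | small _ s  = ⊥-elim (linear (x ∷ []) (λ x → # 1 ≺ 3 · x ⇒ 3 · x ≼ # 1 ⇒ ⊢⊥) h s)
... | _ | medium _ _ = ≤-refl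
... | _ | large _    = linear [] (⊢ # 1 ≼ # 4)

bonus-half : ∀ x → 1ℚ < ι 2 * x → ι 4 ≤ bonus x
bonus-half x h with bonus x | class x
... | _ | tiny t     = ⊥-elim (linear (x ∷ []) (λ x → # 1 ≺ 2 · x ⇒ 6 · x ≼ # 1 ⇒ ⊢⊥) h t)
... | _ | small _ s  = ⊥-elim (linear (x ∷ []) (λ x → # 1 ≺ 2 · x ⇒ 3 · x ≼ # 1 ⇒ ⊢⊥) h s)
... | _ | medium _ m = ⊥-elim (linear (x ∷ []) (λ x → # 1 ≺ 2 · x ⇒ 2 · x ≼ # 1 ⇒ ⊢⊥) h m)
... | _ | large _    = ≤-refl

bonus-≤-half : ∀ x → ι 2 * x ≤ 1ℚ → bonus x ≤ 1ℚ
bonus-≤-half x h with bonus x | class x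
... | _ | tiny t     = linear [] (⊢ # 0 ≼ # 1)
... | _ | small _ s  = linear (x ∷ []) (λ x → 3 · x ≼ # 1 ⇒ ⊢ 6 · x ⊖ # 1 ≼ # 1) s
... | _ | medium _ _ = ≤-refl
... | _ | large l    = ⊥-elim (linear (x ∷ []) (λ x → 2 · x ≼ # 1 ⇒ # 1 ≺ 2 · x ⇒ ⊢⊥) h l)

-- The ratio of bonus to size is largest at 1/3, where the line of slope 3 touches. It keeps the
-- bonuses of a bin without large items below 3.
bonus-≤-linear : ∀ x → 0ℚ ≤ x → ι 2 * x ≤ 1ℚ → bonus x ≤ ι 3 * x
bonus-≤-linear x 0≤x h with bonus x | class x
... | _ | tiny t     = linear (x ∷ []) (λ x → # 0 ≼ x ⇒ ⊢ # 0 ≼ 3 · x) 0≤x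
... | _ | small _ s  = linear (x ∷ []) (λ x → 3 · x ≼ # 1 ⇒ ⊢ 6 · x ⊖ # 1 ≼ 3 · x) s
... | _ | medium m _ = linear (x ∷ []) (λ x → # 1 ≺ 3 · x ⇒ ⊢ # 1 ≼ 3 · x) m
... | _ | large l    = ⊥-elim (linear (x ∷ []) (λ x → 2 · x ≼ # 1 ⇒ # 1 ≺ 2 · x ⇒ ⊢⊥) h l)

-- The chord bound that makes two items not fitting into a bin of level p pay for its deficit.
bonus-gap : ∀ p x → ι 2 ≤ ι 3 * p → 1ℚ < x + p → ι 5 ≤ ι 6 * p + bonus x
bonus-gap p x h g with bonus x | class x
... | _ | tiny t     = linear (p ∷ x ∷ []) (λ p x → # 1 ≺ x ⊕ p ⇒ 6 · x ≼ # 1 ⇒ ⊢ # 5 ≼ 6 · p ⊕ # 0) g t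
... | _ | small _ _  = linear (p ∷ x ∷ []) (λ p x → # 1 ≺ x ⊕ p ⇒ ⊢ # 5 ≼ 6 · p ⊕ (6 · x ⊖ # 1)) g
... | _ | medium _ _ = linear (p ∷ []) (λ p → # 2 ≼ 3 · p ⇒ ⊢ # 5 ≼ 6 · p ⊕ # 1) h
... | _ | large _    = linear (p ∷ []) (λ p → # 2 ≼ 3 · p ⇒ ⊢ # 5 ≼ 6 · p ⊕ # 4) h

bonus-≤4 : ∀ x → bonus x ≤ ι 4
bonus-≤4 x with bonus x | class x
... | _ | tiny _     = linear [] (⊢ # 0 ≼ # 4)
... | _ | small _ s  = linear (x ∷ []) (λ x → 3 · x ≼ # 1 ⇒ ⊢ 6 · x ⊖ # 1 ≼ # 4) s
... | _ | medium _ _ = linear [] (⊢ # 1 ≼ # 4)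
... | _ | large _    = ≤-refl

bonus-mono : ∀ x y → x ≤ y → bonus x ≤ bonus y
bonus-mono x y h with bonus x | class x
... | _ | tiny _     = bonus-≥0 y
... | _ | medium m _ = bonus-third y (linear (x ∷ y ∷ []) (λ x y → x ≼ y ⇒ # 1 ≺ 3 · x ⇒ ⊢ # 1 ≺ 3 · y) h m)
... | _ | large l    = bonus-half y (linear (x ∷ y ∷ []) (λ x y → x ≼ y ⇒ # 1 ≺ 2 · x ⇒ ⊢ # 1 ≺ 2 · y) h l)
... | _ | small s s′ with bonus y | class y
...   | _ | tiny t     = ⊥-elim (linear (x ∷ y ∷ []) (λ x y → x ≼ y ⇒ # 1 ≺ 6 · x ⇒ 6 · y ≼ # 1 ⇒ ⊢⊥) h s t)
...   | _ | small _ _  = linear (x ∷ y ∷ []) (λ x y → x ≼ y ⇒ ⊢ 6 · x ⊖ # 1 ≼ 6 · y ⊖ # 1) h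
...   | _ | medium _ _ = linear (x ∷ []) (λ x → 3 · x ≼ # 1 ⇒ ⊢ 6 · x ⊖ # 1 ≼ # 1) s′
...   | _ | large _    = linear (x ∷ []) (λ x → 3 · x ≼ # 1 ⇒ ⊢ 6 · x ⊖ # 1 ≼ # 4) s′

bonus-sum-≤1 : ∀ x y → ι 2 * (x + y) ≤ 1ℚ → 1ℚ < ι 6 * x → 1ℚ < ι 6 * y → bonus x + bonus y ≤ 1ℚ
bonus-sum-≤1 x y h hx hy with bonus x | class x | bonus y | class y
... | _ | tiny t     | _ | _          = ⊥-elim (linear (x ∷ []) (λ x → # 1 ≺ 6 · x ⇒ 6 · x ≼ # 1 ⇒ ⊢⊥) hx t)
... | _ | medium m _ | _ | _          = ⊥-elim (linear (x ∷ y ∷ []) (λ x y → 2 · (x ⊕ y) ≼ # 1 ⇒ # 1 ≺ 3 · x ⇒ # 1 ≺ 6 · y ⇒ ⊢⊥) h m hy)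
... | _ | large m    | _ | _          = ⊥-elim (linear (x ∷ y ∷ []) (λ x y → 2 · (x ⊕ y) ≼ # 1 ⇒ # 1 ≺ 2 · x ⇒ # 1 ≺ 6 · y ⇒ ⊢⊥) h m hy)
... | _ | small _ _  | _ | tiny t     = ⊥-elim (linear (y ∷ []) (λ y → # 1 ≺ 6 · y ⇒ 6 · y ≼ # 1 ⇒ ⊢⊥) hy t)
... | _ | small _ _  | _ | medium m _ = ⊥-elim (linear (x ∷ y ∷ []) (λ x y → 2 · (x ⊕ y) ≼ # 1 ⇒ # 1 ≺ 6 · x ⇒ # 1 ≺ 3 · y ⇒ ⊢⊥) h hx m)
... | _ | small _ _  | _ | large m    = ⊥-elim (linear (x ∷ y ∷ []) (λ x y → 2 · (x ⊕ y) ≼ # 1 ⇒ # 1 ≺ 6 · x ⇒ # 1 ≺ 2 · y ⇒ ⊢⊥) h hx m)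
... | _ | small _ _  | _ | small _ _  = linear (x ∷ y ∷ []) (λ x y → 2 · (x ⊕ y) ≼ # 1 ⇒ ⊢ (6 · x ⊖ # 1) ⊕ (6 · y ⊖ # 1) ≼ # 1) h

bonus-tiny : ∀ x → ι 6 * x ≤ 1ℚ → bonus x ≤ 0ℚ
bonus-tiny x h with bonus x | class x
... | _ | tiny _     = ≤-refl
... | _ | small s _  = ⊥-elim (linear (x ∷ []) (λ x → 6 · x ≼ # 1 ⇒ # 1 ≺ 6 · x ⇒ ⊢⊥) h s)
... | _ | medium m _ = ⊥-elim (linear (x ∷ []) (λ x → 6 · x ≼ # 1 ⇒ # 1 ≺ 3 · x ⇒ ⊢⊥) h m)
... | _ | large l    = ⊥-elim (linear (x ∷ []) (λ x → 6 · x ≼ # 1 ⇒ # 1 ≺ 2 · x ⇒ ⊢⊥) h l)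

-- A tiny item has no bonus, and monotonicity does the rest. Two items above 1/6 have a sum above
-- 1/3, whose bonus is at least 1, while theirs add up to at most 6/2 - 2 = 1. This allows all items
-- beside a large one to be merged into one item.
bonus-superadditive : ∀ x y → 0ℚ ≤ x → 0ℚ ≤ y → ι 2 * (x + y) ≤ 1ℚ → bonus x + bonus y ≤ bonus (x + y)
bonus-superadditive x y 0≤x 0≤y h = cases (ι 6 * x ≤? 1ℚ) (ι 6 * y ≤? 1ℚ)
  where
  cases : Dec (ι 6 * x ≤ 1ℚ) → Dec (ι 6 * y ≤ 1ℚ) → bonus x + bonus y ≤ bonus (x + y)
  cases (no ¬t) (no ¬u) = ≤-trans (bonus-sum-≤1 x y h (≰⇒> ¬t) (≰⇒> ¬u)) (bonus-third (x + y)
    (linear (x ∷ y ∷ []) (λ x y → # 1 ≺ 6 · x ⇒ # 1 ≺ 6 · y ⇒ ⊢ # 1 ≺ 3 · (x ⊕ y)) (≰⇒> ¬t) (≰⇒> ¬u)))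
  cases (yes t) _ = linear (bonus x ∷ bonus y ∷ bonus (x + y) ∷ [])
    (λ a b c → a ≼ # 0 ⇒ b ≼ c ⇒ ⊢ a ⊕ b ≼ c) (bonus-tiny x t)
    (bonus-mono y (x + y) (linear (x ∷ y ∷ []) (λ x y → # 0 ≼ x ⇒ ⊢ y ≼ x ⊕ y) 0≤x))
  cases (no _) (yes u) = linear (bonus x ∷ bonus y ∷ bonus (x + y) ∷ [])
    (λ a b c → b ≼ # 0 ⇒ a ≼ c ⇒ ⊢ a ⊕ b ≼ c) (bonus-tiny y u)
    (bonus-mono x (x + y) (linear (x ∷ y ∷ []) (λ x y → # 0 ≼ y ⇒ ⊢ x ≼ x ⊕ y) 0≤y))

-- The weight of the contents of one bin

sum-≥0 : ∀ {xs} → All (0ℚ ≤_) xs → 0ℚ ≤ sumℚ xs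
sum-≥0 [] = ≤-refl
sum-≥0 {x ∷ xs} (p ∷ ps) = linear (x ∷ sumℚ xs ∷ []) (λ x s → # 0 ≼ x ⇒ # 0 ≼ s ⇒ ⊢ # 0 ≼ x ⊕ s) p (sum-≥0 ps)

bonuses : List ℚ → ℚ
bonuses xs = sumℚ (map bonus xs)

bonuses-≤-bonus-sum : ∀ xs → All (0ℚ ≤_) xs → ι 2 * sumℚ xs ≤ 1ℚ → bonuses xs ≤ bonus (sumℚ xs)
bonuses-≤-bonus-sum []       []       h = bonus-≥0 0ℚ
bonuses-≤-bonus-sum (x ∷ xs) (p ∷ ps) h =
  linear (bonus x ∷ bonuses xs ∷ bonus (sumℚ xs) ∷ bonus (x + sumℚ xs) ∷ [])
    (λ a b c d → b ≼ c ⇒ a ⊕ c ≼ d ⇒ ⊢ a ⊕ b ≼ d)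
    (bonuses-≤-bonus-sum xs ps (linear (x ∷ sumℚ xs ∷ [])
      (λ x s → # 0 ≼ x ⇒ 2 · (x ⊕ s) ≼ # 1 ⇒ ⊢ 2 · s ≼ # 1) p h))
    (bonus-superadditive x (sumℚ xs) p (sum-≥0 ps) h)

-- In one-large, r is the total size of the items other than the one exceeding 1/2.
data Split (xs : List ℚ) : Set where
  no-large  : bonuses xs ≤ ι 3 * sumℚ xs → Split xs
  one-large : ∀ r → 0ℚ ≤ r → 1ℚ + ι 2 * r < ι 2 * sumℚ xs → bonuses xs ≤ ι 4 + bonus r → Split xs

split : ∀ xs → All (0ℚ ≤_) xs → sumℚ xs ≤ 1ℚ → Split xs
split []       []       h = no-large (linear [] (⊢ # 0 ≼ 3 · # 0))
split (x ∷ xs) (p ∷ ps) h =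
  cases (ι 2 * x ≤? 1ℚ) (split xs ps (linear (x ∷ sumℚ xs ∷ []) (λ x s → # 0 ≼ x ⇒ x ⊕ s ≼ # 1 ⇒ ⊢ s ≼ # 1) p h))
  where
  cases : Dec (ι 2 * x ≤ 1ℚ) → Split xs → Split (x ∷ xs)
  cases (yes x≤½) (no-large b) = no-large (linear (x ∷ sumℚ xs ∷ bonus x ∷ bonuses xs ∷ [])
    (λ x s a b → a ≼ 3 · x ⇒ b ≼ 3 · s ⇒ ⊢ a ⊕ b ≼ 3 · (x ⊕ s)) (bonus-≤-linear x p x≤½) b)
  cases (yes x≤½) (one-large r 0≤r r< b) = one-large (x + r)
    (linear (x ∷ r ∷ []) (λ x r → # 0 ≼ x ⇒ # 0 ≼ r ⇒ ⊢ # 0 ≼ x ⊕ r) p 0≤r)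
    (linear (x ∷ r ∷ sumℚ xs ∷ []) (λ x r s → # 1 ⊕ 2 · r ≺ 2 · s ⇒ ⊢ # 1 ⊕ 2 · (x ⊕ r) ≺ 2 · (x ⊕ s)) r<)
    (linear (bonus x ∷ bonuses xs ∷ bonus r ∷ bonus (x + r) ∷ [])
      (λ a b c d → b ≼ # 4 ⊕ c ⇒ a ⊕ c ≼ d ⇒ ⊢ a ⊕ b ≼ # 4 ⊕ d) b
      (bonus-superadditive x r p 0≤r (linear (x ∷ r ∷ sumℚ xs ∷ [])
        (λ x r s → # 1 ⊕ 2 · r ≺ 2 · s ⇒ x ⊕ s ≼ # 1 ⇒ ⊢ 2 · (x ⊕ r) ≼ # 1) r< h)))
  cases (no x≰½) (no-large _) = one-large (sumℚ xs) (sum-≥0 ps)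
    (linear (x ∷ sumℚ xs ∷ []) (λ x s → # 1 ≺ 2 · x ⇒ ⊢ # 1 ⊕ 2 · s ≺ 2 · (x ⊕ s)) (≰⇒> x≰½))
    (linear (bonus x ∷ bonuses xs ∷ bonus (sumℚ xs) ∷ []) (λ a b c → a ≼ # 4 ⇒ b ≼ c ⇒ ⊢ a ⊕ b ≼ # 4 ⊕ c)
      (bonus-≤4 x) (bonuses-≤-bonus-sum xs ps
        (linear (x ∷ sumℚ xs ∷ []) (λ x s → # 1 ≺ 2 · x ⇒ x ⊕ s ≼ # 1 ⇒ ⊢ 2 · s ≼ # 1) (≰⇒> x≰½) h)))
  cases (no x≰½) (one-large r 0≤r r< b) = ⊥-elim (linear (x ∷ r ∷ sumℚ xs ∷ [])
    (λ x r s → # 0 ≼ r ⇒ # 1 ⊕ 2 · r ≺ 2 · s ⇒ # 1 ≺ 2 · x ⇒ x ⊕ s ≼ # 1 ⇒ ⊢⊥) 0≤r r< (≰⇒> x≰½) h)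

weights : List ℚ → ℚ
weights xs = sumℚ (map weight xs)

weights≡ : ∀ xs → weights xs ≡ ι 12 * sumℚ xs + bonuses xs
weights≡ []       = linear [] (⊢ # 0 ≈ 12 · # 0 ⊕ # 0)
weights≡ (x ∷ xs) = linear (x ∷ sumℚ xs ∷ bonus x ∷ bonuses xs ∷ weights xs ∷ [])
  (λ x s a b w → w ≈ 12 · s ⊕ b ⇒ ⊢ (12 · x ⊕ a) ⊕ w ≈ 12 · (x ⊕ s) ⊕ (a ⊕ b)) (weights≡ xs)

-- The size contributes 12 and the bonuses 5: a large item has 4, and the rest, being less than 1/2,
-- has at most 1 when merged.
weights-≤17 : ∀ xs → All (0ℚ ≤_) xs → sumℚ xs ≤ 1ℚ → weights xs ≤ ι 17
weights-≤17 xs ps h = linear (weights xs ∷ sumℚ xs ∷ bonuses xs ∷ [])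
  (λ w s b → w ≈ 12 · s ⊕ b ⇒ s ≼ # 1 ⇒ b ≼ # 5 ⇒ ⊢ w ≼ # 17) (weights≡ xs) h (bonuses-≤5 (split xs ps h))
  where
  bonuses-≤5 : Split xs → bonuses xs ≤ ι 5
  bonuses-≤5 (no-large b) = linear (sumℚ xs ∷ bonuses xs ∷ []) (λ s b → b ≼ 3 · s ⇒ s ≼ # 1 ⇒ ⊢ b ≼ # 5) b h
  bonuses-≤5 (one-large r _ r< b) = linear (bonuses xs ∷ bonus r ∷ [])
    (λ b c → b ≼ # 4 ⊕ c ⇒ c ≼ # 1 ⇒ ⊢ b ≼ # 5) b (bonus-≤-half r (linear (r ∷ sumℚ xs ∷ [])
      (λ r s → # 1 ⊕ 2 · r ≺ 2 · s ⇒ s ≼ # 1 ⇒ ⊢ 2 · r ≼ # 1) r< h))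

-- Bounded Best-Fit

-- The state of Bounded Best-Fit with an older open bin of load p, a newer one of load q and N closed
-- bins, W being ten times the total weight packed. The bonus of a bin compensates the deficit of
-- another one, so b is the part of the bonuses not yet spent:
--   paid:  enough is left to close either bin;
--   fresh: the newer bin holds a single item of size at most 1/2;
--   stuck: a bin of load x has been closed on credit, since the bin of load p then was fresh; all
--          bins opened from then on start with an item larger than 1/2.
data Ledger (p q N W : ℚ) : Set where
  paid  : ∀ b → ι 10 * N + ι 12 * (p + q) + b ≤ W →
    ι 10 ≤ b + ι 12 * p ⊎ ι 10 ≤ b + ι 12 * q → Ledger p q N W
  fresh : ∀ b → ι 10 * N + ι 12 * (p + q) + b ≤ W →
    ι 2 * q ≤ 1ℚ → bonus q ≤ b → Ledger p q N W
  stuck : ∀ x b → ι 10 * N + ι 12 * (x + p + q) + b ≤ ι 10 + W →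
    1ℚ < x + p → ι 2 * p ≤ 1ℚ → ι 4 + bonus p ≤ b → Ledger p q N W

-- The common restart once a bin has been closed and paid for: no bonus is left over, and a first
-- item above 1/2 earns 6 + 4 and so secures its own bin at once.
open-second : ∀ {p N W} s → ι 10 * N + ι 12 * p ≤ W → Ledger p s N (W + weight s)
open-second {p} {N} {W} s h = cases (ι 2 * s ≤? 1ℚ)
  where
  bound : ι 10 * N + ι 12 * (p + s) + bonus s ≤ W + weight s
  bound = linear (p ∷ N ∷ W ∷ s ∷ bonus s ∷ [])
    (λ p N W s b → 10 · N ⊕ 12 · p ≼ W ⇒ ⊢ 10 · N ⊕ 12 · (p ⊕ s) ⊕ b ≼ W ⊕ (12 · s ⊕ b)) h
  cases : Dec (ι 2 * s ≤ 1ℚ) → Ledger p s N (W + weight s)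
  cases (yes s≤½) = fresh (bonus s) bound s≤½ ≤-refl
  cases (no  s≰½) = paid (bonus s) bound (inj₂ (linear (s ∷ bonus s ∷ [])
    (λ s b → # 1 ≺ 2 · s ⇒ # 4 ≼ b ⇒ ⊢ # 10 ≼ b ⊕ 12 · s) (≰⇒> s≰½) (bonus-half s (≰⇒> s≰½))))

close-older : ∀ {p q N W} s → Ledger p q N W → 1ℚ < p + q → q ≤ p → 1ℚ < q + s →
  Ledger q s (1ℚ + N) (W + weight s)
close-older {p} {q} {N} {W} s (paid b h c) pq q≤p qs = open-second s (linear (p ∷ q ∷ N ∷ W ∷ b ∷ [])
  (λ p q N W b → 10 · N ⊕ 12 · (p ⊕ q) ⊕ b ≼ W ⇒ # 10 ≼ b ⊕ 12 · p ⇒ ⊢ 10 · (# 1 ⊕ N) ⊕ 12 · q ≼ W) h (fuller c))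
  where
  -- The fuller bin is the one closed, so if the funds suffice for either bin, they suffice for it.
  fuller : ι 10 ≤ b + ι 12 * p ⊎ ι 10 ≤ b + ι 12 * q → ι 10 ≤ b + ι 12 * p
  fuller (inj₁ c) = c
  fuller (inj₂ c) = linear (p ∷ q ∷ b ∷ []) (λ p q b → # 10 ≼ b ⊕ 12 · q ⇒ q ≼ p ⇒ ⊢ # 10 ≼ b ⊕ 12 · p) c q≤p
-- The loan is taken here: `q` becomes the older bin, and `s`, not fitting beside a load of at most
-- 1/2, is large and adds a bonus of 4 to the reserve.
close-older {p} {q} {N} {W} s (fresh b h q≤½ c) pq q≤p qs = stuck p (b + bonus s)
  (linear (p ∷ q ∷ N ∷ W ∷ b ∷ s ∷ bonus s ∷ []) (λ p q N W b s bs → 10 · N ⊕ 12 · (p ⊕ q) ⊕ b ≼ W ⇒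
    ⊢ 10 · (# 1 ⊕ N) ⊕ 12 · (p ⊕ q ⊕ s) ⊕ (b ⊕ bs) ≼ # 10 ⊕ (W ⊕ (12 · s ⊕ bs))) h)
  pq q≤½ (linear (b ∷ bonus q ∷ bonus s ∷ [])
    (λ b bq bs → bq ≼ b ⇒ # 4 ≼ bs ⇒ ⊢ # 4 ⊕ bq ≼ b ⊕ bs) c
    (bonus-half s (linear (q ∷ s ∷ []) (λ q s → 2 · q ≼ # 1 ⇒ # 1 ≺ q ⊕ s ⇒ ⊢ # 1 ≺ 2 · s) q≤½ qs)))
close-older {p} {q} s (stuck x b h xp p≤½ c) pq q≤p qs = ⊥-elim (linear (p ∷ q ∷ [])
  (λ p q → # 1 ≺ p ⊕ q ⇒ q ≼ p ⇒ 2 · p ≼ # 1 ⇒ ⊢⊥) pq q≤p p≤½)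

close-newer : ∀ {p q N W} s → Ledger p q N W → 1ℚ < p + q → p ≤ q → 1ℚ < p + s →
  Ledger p s (1ℚ + N) (W + weight s)
close-newer {p} {q} {N} {W} s (paid b h c) pq p≤q ps = open-second s (linear (p ∷ q ∷ N ∷ W ∷ b ∷ [])
  (λ p q N W b → 10 · N ⊕ 12 · (p ⊕ q) ⊕ b ≼ W ⇒ # 10 ≼ b ⊕ 12 · q ⇒ ⊢ 10 · (# 1 ⊕ N) ⊕ 12 · p ≼ W) h (fuller c))
  where
  fuller : ι 10 ≤ b + ι 12 * p ⊎ ι 10 ≤ b + ι 12 * q → ι 10 ≤ b + ι 12 * q
  fuller (inj₂ c) = c
  fuller (inj₁ c) = linear (p ∷ q ∷ b ∷ []) (λ p q b → # 10 ≼ b ⊕ 12 · p ⇒ p ≼ q ⇒ ⊢ # 10 ≼ b ⊕ 12 · q) c p≤q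
close-newer {p} {q} s (fresh b h q≤½ c) pq p≤q ps = ⊥-elim (linear (p ∷ q ∷ [])
  (λ p q → # 1 ≺ p ⊕ q ⇒ p ≼ q ⇒ 2 · q ≼ # 1 ⇒ ⊢⊥) pq p≤q q≤½)
-- As `p` is at most 1/2, `q` exceeds 1/2 and yields 6; the 4 in reserve completes the 10. The bonus
-- of `s`, which is large as well, restores the 4.
close-newer {p} {q} {N} {W} s (stuck x b h xp p≤½ c) pq p≤q ps = stuck x (bonus p + bonus s)
  (linear (p ∷ q ∷ N ∷ W ∷ b ∷ s ∷ bonus s ∷ x ∷ bonus p ∷ []) (λ p q N W b s bs x bp →
    10 · N ⊕ 12 · (x ⊕ p ⊕ q) ⊕ b ≼ # 10 ⊕ W ⇒ # 1 ≺ p ⊕ q ⇒ 2 · p ≼ # 1 ⇒ # 4 ⊕ bp ≼ b ⇒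
    ⊢ 10 · (# 1 ⊕ N) ⊕ 12 · (x ⊕ p ⊕ s) ⊕ (bp ⊕ bs) ≼ # 10 ⊕ (W ⊕ (12 · s ⊕ bs))) h pq p≤½ c)
  xp p≤½ (linear (bonus p ∷ bonus s ∷ []) (λ bp bs → # 4 ≼ bs ⇒ ⊢ # 4 ⊕ bp ≼ bp ⊕ bs)
    (bonus-half s (linear (p ∷ s ∷ []) (λ q s → 2 · q ≼ # 1 ⇒ # 1 ≺ q ⊕ s ⇒ ⊢ # 1 ≺ 2 · s) p≤½ ps)))

private
  -- 20 pays both for the bin of load x, closed on credit, and for closing one of the two open bins.
  settle : ∀ {x p q} t b → 1ℚ < x + p → ι 2 * p ≤ 1ℚ → ι 4 + bonus p ≤ b → 1ℚ < p + q → 1ℚ < q + t →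
    ι 20 ≤ b + bonus t + ι 12 * (x + (p + t)) ⊎ ι 20 ≤ b + bonus t + ι 12 * (x + q)
  settle {x} {p} {q} t b xp p≤½ c pq qt = cases (class t) (ι 3 * p ≤? 1ℚ)
    where
    4≤b : ι 4 ≤ b
    4≤b = linear (b ∷ bonus p ∷ []) (λ b bp → # 4 ⊕ bp ≼ b ⇒ # 0 ≼ bp ⇒ ⊢ # 4 ≼ b) c (bonus-≥0 p)
    cases : ∀ {bt} → Class t bt → Dec (ι 3 * p ≤ 1ℚ) →
      ι 20 ≤ b + bt + ι 12 * (x + (p + t)) ⊎ ι 20 ≤ b + bt + ι 12 * (x + q)
    cases (medium m _) _ = inj₁ (linear (x ∷ p ∷ t ∷ b ∷ []) (λ x p t b →
      # 1 ≺ x ⊕ p ⇒ # 1 ≺ 3 · t ⇒ # 4 ≼ b ⇒ ⊢ # 20 ≼ b ⊕ # 1 ⊕ 12 · (x ⊕ (p ⊕ t))) xp m 4≤b)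
    cases (large l) _ = inj₁ (linear (x ∷ p ∷ t ∷ b ∷ []) (λ x p t b →
      # 1 ≺ x ⊕ p ⇒ # 1 ≺ 2 · t ⇒ # 4 ≼ b ⇒ ⊢ # 20 ≼ b ⊕ # 4 ⊕ 12 · (x ⊕ (p ⊕ t))) xp l 4≤b)
    -- Now `x` exceeds 1/2 and `q` exceeds 5/6, which gives 16 besides the reserve of 4.
    cases (tiny t≤) _ = inj₂ (linear (x ∷ p ∷ q ∷ t ∷ b ∷ []) (λ x p q t b →
      # 1 ≺ x ⊕ p ⇒ 2 · p ≼ # 1 ⇒ # 1 ≺ q ⊕ t ⇒ 6 · t ≼ # 1 ⇒ # 4 ≼ b ⇒
      ⊢ # 20 ≼ b ⊕ # 0 ⊕ 12 · (x ⊕ q)) xp p≤½ qt t≤ 4≤b)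
    cases (small <t t≤) (yes p≤) = inj₂ (linear (x ∷ p ∷ q ∷ t ∷ b ∷ []) (λ x p q t b →
      # 1 ≺ x ⊕ p ⇒ 3 · p ≼ # 1 ⇒ # 1 ≺ q ⊕ t ⇒ 3 · t ≼ # 1 ⇒ # 4 ≼ b ⇒ # 1 ≺ 6 · t ⇒
      ⊢ # 20 ≼ b ⊕ (6 · t ⊖ # 1) ⊕ 12 · (x ⊕ q)) xp p≤ qt t≤ 4≤b <t)
    -- For `p` above 1/3 the bound on `x` drops from 2/3 to 1/2; the bonus of `p`, kept in reserve
    -- for this case, makes up for it.
    cases (small _ t≤) (no p≰) = inj₂ (linear (x ∷ p ∷ q ∷ t ∷ b ∷ bonus p ∷ []) (λ x p q t b bp →
      # 1 ≺ x ⊕ p ⇒ 2 · p ≼ # 1 ⇒ # 1 ≺ q ⊕ t ⇒ 3 · t ≼ # 1 ⇒ # 4 ⊕ bp ≼ b ⇒ # 1 ≼ bp ⇒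
      ⊢ # 20 ≼ b ⊕ (6 · t ⊖ # 1) ⊕ 12 · (x ⊕ q)) xp p≤½ qt t≤ c (bonus-third p (≰⇒> p≰)))

add-older : ∀ {p q N W} t → Ledger p q N W → 0ℚ ≤ t → 1ℚ < p + q → 1ℚ < q + t ⊎ q ≤ p →
  Ledger (p + t) q N (W + weight t)
add-older {p} {q} {N} {W} t (paid b h c) 0≤t pq d = paid (b + bonus t)
  (linear (p ∷ q ∷ N ∷ W ∷ b ∷ t ∷ bonus t ∷ []) (λ p q N W b t bt →
    10 · N ⊕ 12 · (p ⊕ q) ⊕ b ≼ W ⇒ ⊢ 10 · N ⊕ 12 · (p ⊕ t ⊕ q) ⊕ (b ⊕ bt) ≼ W ⊕ (12 · t ⊕ bt)) h)
  (keep c)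
  where
  keep : ι 10 ≤ b + ι 12 * p ⊎ ι 10 ≤ b + ι 12 * q →
    ι 10 ≤ b + bonus t + ι 12 * (p + t) ⊎ ι 10 ≤ b + bonus t + ι 12 * q
  keep (inj₁ c) = inj₁ (linear (p ∷ b ∷ t ∷ bonus t ∷ []) (λ p b t bt →
    # 10 ≼ b ⊕ 12 · p ⇒ # 0 ≼ t ⇒ # 0 ≼ bt ⇒ ⊢ # 10 ≼ b ⊕ bt ⊕ 12 · (p ⊕ t)) c 0≤t (bonus-≥0 t))
  keep (inj₂ c) = inj₂ (linear (q ∷ b ∷ bonus t ∷ []) (λ q b bt →
    # 10 ≼ b ⊕ 12 · q ⇒ # 0 ≼ bt ⇒ ⊢ # 10 ≼ b ⊕ bt ⊕ 12 · q) c (bonus-≥0 t))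
add-older {p} {q} {N} {W} t (fresh b h q≤½ c) 0≤t pq d = fresh b
  (linear (p ∷ q ∷ N ∷ W ∷ b ∷ t ∷ bonus t ∷ []) (λ p q N W b t bt →
    10 · N ⊕ 12 · (p ⊕ q) ⊕ b ≼ W ⇒ # 0 ≼ bt ⇒ ⊢ 10 · N ⊕ 12 · (p ⊕ t ⊕ q) ⊕ b ≼ W ⊕ (12 · t ⊕ bt))
    h (bonus-≥0 t))
  q≤½ c
add-older {p} {q} t (stuck x b h xp p≤½ c) 0≤t pq (inj₂ q≤p) = ⊥-elim (linear (p ∷ q ∷ [])
  (λ p q → # 1 ≺ p ⊕ q ⇒ q ≼ p ⇒ 2 · p ≼ # 1 ⇒ ⊢⊥) pq q≤p p≤½)
add-older {p} {q} {N} {W} t (stuck x b h xp p≤½ c) 0≤t pq (inj₁ qt) =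
  paid (b + bonus t + ι 12 * x - ι 10)
    (linear (p ∷ q ∷ N ∷ W ∷ b ∷ t ∷ bonus t ∷ x ∷ []) (λ p q N W b t bt x →
      10 · N ⊕ 12 · (x ⊕ p ⊕ q) ⊕ b ≼ # 10 ⊕ W ⇒
      ⊢ 10 · N ⊕ 12 · (p ⊕ t ⊕ q) ⊕ (b ⊕ bt ⊕ 12 · x ⊖ # 10) ≼ W ⊕ (12 · t ⊕ bt)) h)
    (shift (settle {x} {p} {q} t b xp p≤½ c pq qt))
  where
  regroup : ∀ u → ι 20 ≤ b + bonus t + ι 12 * (x + u) → ι 10 ≤ b + bonus t + ι 12 * x - ι 10 + ι 12 * u
  regroup u = linear (b ∷ bonus t ∷ x ∷ u ∷ []) λ b bt x u →
    # 20 ≼ b ⊕ bt ⊕ 12 · (x ⊕ u) ⇒ ⊢ # 10 ≼ b ⊕ bt ⊕ 12 · x ⊖ # 10 ⊕ 12 · u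
  shift : ι 20 ≤ b + bonus t + ι 12 * (x + (p + t)) ⊎ ι 20 ≤ b + bonus t + ι 12 * (x + q) → _
  shift (inj₁ c) = inj₁ (regroup (p + t) c)
  shift (inj₂ c) = inj₂ (regroup q c)

add-newer : ∀ {p q N W} t → Ledger p q N W → 0ℚ ≤ t → 1ℚ < p + q → 1ℚ < p + t ⊎ p ≤ q →
  Ledger p (q + t) N (W + weight t)
add-newer {p} {q} {N} {W} t (paid b h c) 0≤t pq d = paid (b + bonus t)
  (linear (p ∷ q ∷ N ∷ W ∷ b ∷ t ∷ bonus t ∷ []) (λ p q N W b t bt →
    10 · N ⊕ 12 · (p ⊕ q) ⊕ b ≼ W ⇒ ⊢ 10 · N ⊕ 12 · (p ⊕ (q ⊕ t)) ⊕ (b ⊕ bt) ≼ W ⊕ (12 · t ⊕ bt)) h)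
  (keep c)
  where
  keep : ι 10 ≤ b + ι 12 * p ⊎ ι 10 ≤ b + ι 12 * q →
    ι 10 ≤ b + bonus t + ι 12 * p ⊎ ι 10 ≤ b + bonus t + ι 12 * (q + t)
  keep (inj₂ c) = inj₂ (linear (q ∷ b ∷ t ∷ bonus t ∷ []) (λ q b t bt →
    # 10 ≼ b ⊕ 12 · q ⇒ # 0 ≼ t ⇒ # 0 ≼ bt ⇒ ⊢ # 10 ≼ b ⊕ bt ⊕ 12 · (q ⊕ t)) c 0≤t (bonus-≥0 t))
  keep (inj₁ c) = inj₁ (linear (p ∷ b ∷ bonus t ∷ []) (λ p b bt →
    # 10 ≼ b ⊕ 12 · p ⇒ # 0 ≼ bt ⇒ ⊢ # 10 ≼ b ⊕ bt ⊕ 12 · p) c (bonus-≥0 t))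
add-newer {p} {q} {N} {W} t (stuck x b h xp p≤½ c) 0≤t pq d = stuck x b
  (linear (p ∷ q ∷ N ∷ W ∷ b ∷ t ∷ bonus t ∷ x ∷ []) (λ p q N W b t bt x →
    10 · N ⊕ 12 · (x ⊕ p ⊕ q) ⊕ b ≼ # 10 ⊕ W ⇒ # 0 ≼ bt ⇒
    ⊢ 10 · N ⊕ 12 · (x ⊕ p ⊕ (q ⊕ t)) ⊕ b ≼ # 10 ⊕ (W ⊕ (12 · t ⊕ bt))) h (bonus-≥0 t))
  xp p≤½ c
add-newer {p} {q} t (fresh b h q≤½ c) 0≤t pq (inj₂ p≤q) = ⊥-elim (linear (p ∷ q ∷ [])
  (λ p q → # 1 ≺ p ⊕ q ⇒ p ≼ q ⇒ 2 · q ≼ # 1 ⇒ ⊢⊥) pq p≤q q≤½)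
add-newer {p} {q} {N} {W} t (fresh b h q≤½ c) 0≤t pq (inj₁ pt) = paid (b + bonus t)
  (linear (p ∷ q ∷ N ∷ W ∷ b ∷ t ∷ bonus t ∷ []) (λ p q N W b t bt →
    10 · N ⊕ 12 · (p ⊕ q) ⊕ b ≼ W ⇒ ⊢ 10 · N ⊕ 12 · (p ⊕ (q ⊕ t)) ⊕ (b ⊕ bt) ≼ W ⊕ (12 · t ⊕ bt)) h)
  -- Neither `q` nor `t` fits beside `p`. From 2/3 on, each of them contributes 5 - 6p to closing
  -- the older bin. Below 2/3, both exceed 1/3, so the newer bin has 8 from its load and 2 from its
  -- bonuses.
  (cases (ι 3 * p <? ι 2))
  where
  cases : Dec (ι 3 * p < ι 2) → ι 10 ≤ b + bonus t + ι 12 * p ⊎ ι 10 ≤ b + bonus t + ι 12 * (q + t)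
  cases (no p≮⅔) = inj₁ (linear (p ∷ b ∷ bonus q ∷ bonus t ∷ []) (λ p b bq bt →
    # 5 ≼ 6 · p ⊕ bq ⇒ # 5 ≼ 6 · p ⊕ bt ⇒ bq ≼ b ⇒ ⊢ # 10 ≼ b ⊕ bt ⊕ 12 · p)
    (bonus-gap p q (≮⇒≥ p≮⅔) (linear (p ∷ q ∷ []) (λ p q → # 1 ≺ p ⊕ q ⇒ ⊢ # 1 ≺ q ⊕ p) pq))
    (bonus-gap p t (≮⇒≥ p≮⅔) (linear (p ∷ t ∷ []) (λ p q → # 1 ≺ p ⊕ q ⇒ ⊢ # 1 ≺ q ⊕ p) pt)) c)
  cases (yes p<⅔) = inj₂ (linear (b ∷ bonus q ∷ bonus t ∷ q ∷ t ∷ []) (λ b bq bt q t →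
    bq ≼ b ⇒ # 1 ≼ bq ⇒ # 1 ≼ bt ⇒ # 1 ≺ 3 · q ⇒ # 1 ≺ 3 · t ⇒ ⊢ # 10 ≼ b ⊕ bt ⊕ 12 · (q ⊕ t))
    c (bonus-third q (third q pq)) (bonus-third t (third t pt)) (third q pq) (third t pt))
    where
    third : ∀ u → 1ℚ < p + u → 1ℚ < ι 3 * u
    third u pu = linear (p ∷ u ∷ []) (λ p u → 3 · p ≺ # 2 ⇒ # 1 ≺ p ⊕ u ⇒ ⊢ # 1 ≺ 3 · u) p<⅔ pu

-- The 10 on the right is a loan still outstanding in the state `stuck`.
closed-bound : ∀ {p q N W} → Ledger p q N W → 0ℚ ≤ p → 0ℚ ≤ q → ι 10 * N ≤ ι 10 + W
closed-bound {p} {q} {N} {W} (paid b h (inj₁ c)) 0≤p 0≤q = linear (p ∷ q ∷ N ∷ W ∷ b ∷ []) (λ p q N W b →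
  10 · N ⊕ 12 · (p ⊕ q) ⊕ b ≼ W ⇒ # 10 ≼ b ⊕ 12 · p ⇒ # 0 ≼ q ⇒ ⊢ 10 · N ≼ # 10 ⊕ W) h c 0≤q
closed-bound {p} {q} {N} {W} (paid b h (inj₂ c)) 0≤p 0≤q = linear (p ∷ q ∷ N ∷ W ∷ b ∷ []) (λ p q N W b →
  10 · N ⊕ 12 · (p ⊕ q) ⊕ b ≼ W ⇒ # 10 ≼ b ⊕ 12 · q ⇒ # 0 ≼ p ⇒ ⊢ 10 · N ≼ # 10 ⊕ W) h c 0≤p
closed-bound {p} {q} {N} {W} (fresh b h q≤½ c) 0≤p 0≤q = linear (p ∷ q ∷ N ∷ W ∷ b ∷ bonus q ∷ [])
  (λ p q N W b bq → 10 · N ⊕ 12 · (p ⊕ q) ⊕ b ≼ W ⇒ bq ≼ b ⇒ # 0 ≼ bq ⇒ # 0 ≼ p ⇒ # 0 ≼ q ⇒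
    ⊢ 10 · N ≼ # 10 ⊕ W) h c (bonus-≥0 q) 0≤p 0≤q
closed-bound {p} {q} {N} {W} (stuck x b h xp p≤½ c) 0≤p 0≤q = linear (p ∷ q ∷ N ∷ W ∷ b ∷ bonus p ∷ x ∷ [])
  (λ p q N W b bp x → 10 · N ⊕ 12 · (x ⊕ p ⊕ q) ⊕ b ≼ # 10 ⊕ W ⇒ # 4 ⊕ bp ≼ b ⇒ # 0 ≼ bp ⇒
    # 1 ≺ x ⊕ p ⇒ # 0 ≼ q ⇒ ⊢ 10 · N ≼ # 10 ⊕ W) h c (bonus-≥0 p) xp 0≤q

-- Sums over classes and packings

ι-suc : ∀ n → ι (suc n) ≡ 1ℚ + ι n
ι-suc n = fromℤ-+ (pos 1) (pos n)

ι-+ : ∀ a b → ι (a ℕ.+ b) ≡ ι a + ι b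
ι-+ a b = fromℤ-+ (pos a) (pos b)

ι-* : ∀ a b → ι (a ℕ.* b) ≡ ι a * ι b
ι-* a b = trans (cong fromℤ (ℤ.pos-* a b)) (fromℤ-* (pos a) (pos b))

ι-mono : ∀ {a b} → a ℕ.≤ b → ι a ≤ ι b
ι-mono a≤b = fromℤ-mono-≤ (ℤ.+≤+ a≤b)

ι-cancel : ∀ {a b} → ι a ≤ ι b → a ℕ.≤ b
ι-cancel h = ℕ.≮⇒≥ λ b<a → <-irrefl refl (<-≤-trans (fromℤ-mono-< (ℤ.+<+ b<a)) h)

ι-≥0 : ∀ n → 0ℚ ≤ ι n
ι-≥0 n = ι-mono {0} {n} ℕ.z≤n

sumF : ∀ {k} → (Fin k → ℚ) → ℚ
sumF {zero}  f = 0ℚ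
sumF {suc k} f = f zero + sumF (f ∘ suc)

sumF-mono : ∀ {k} {f g : Fin k → ℚ} → (∀ c → f c ≤ g c) → sumF f ≤ sumF g
sumF-mono {zero}  h = ≤-refl
sumF-mono {suc k} h = +-mono-≤ (h zero) (sumF-mono (h ∘ suc))

sumF-cong : ∀ {k} {f g : Fin k → ℚ} → (∀ c → f c ≡ g c) → sumF f ≡ sumF g
sumF-cong {zero}  h = refl
sumF-cong {suc k} h = cong₂ _+_ (h zero) (sumF-cong (h ∘ suc))

sumF-zero : ∀ k → sumF {k} (λ _ → 0ℚ) ≡ 0ℚ
sumF-zero zero    = refl
sumF-zero (suc k) = trans (+-identityˡ _) (sumF-zero k)

sumF-+ : ∀ {k} (f g : Fin k → ℚ) → sumF (λ c → f c + g c) ≡ sumF f + sumF g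
sumF-+ {zero}  f g = refl
sumF-+ {suc k} f g = linear (f zero ∷ g zero ∷ sumF (f ∘ suc) ∷ sumF (g ∘ suc) ∷ sumF (λ c → f (suc c) + g (suc c)) ∷ [])
  (λ a b F G H → H ≈ F ⊕ G ⇒ ⊢ (a ⊕ b) ⊕ H ≈ (a ⊕ F) ⊕ (b ⊕ G)) (sumF-+ (f ∘ suc) (g ∘ suc))

sumF-≤ : ∀ {k} (f : Fin k → ℚ) n → (∀ c → f c ≤ ι n) → sumF f ≤ ι (n ℕ.* k)
sumF-≤ {zero}  f n h = ι-≥0 (n ℕ.* 0)
sumF-≤ {suc k} f n h = subst (f zero + sumF (f ∘ suc) ≤_)
  (trans (sym (ι-+ n (n ℕ.* k))) (cong ι (sym (ℕ.*-suc n k))))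
  (+-mono-≤ (h zero) (sumF-≤ (f ∘ suc) n (h ∘ suc)))

sumF-scale : ∀ {k} n (f : Fin k → ℚ) → sumF (λ c → ι n * f c) ≡ ι n * sumF f
sumF-scale {zero}  n f = sym (*-zeroʳ (ι n))
sumF-scale {suc k} n f = trans (cong (ι n * f zero +_) (sumF-scale n (f ∘ suc))) (sym (*-distribˡ-+ (ι n) _ _))

indicator : ∀ {k} → Fin k → ℚ → Fin k → ℚ
indicator c′ x c = if does (c′ ≟ c) then x else 0ℚ

sumF-indicator : ∀ {k} (c′ : Fin k) x → sumF (indicator c′ x) ≡ x
sumF-indicator {suc k} zero     x = trans (cong (x +_) (sumF-zero k)) (+-identityʳ x)
sumF-indicator {suc k} (suc c′) x = trans (+-identityˡ _) (sumF-indicator c′ x)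

classSum : ∀ {k} → Fin k → List (Fin k × ℚ) → ℚ
classSum c []             = 0ℚ
classSum c ((c′ , x) ∷ L) = indicator c′ x c + classSum c L

classSums : ∀ {k} (L : List (Fin k × ℚ)) → sumF (λ c → classSum c L) ≡ sumℚ (map proj₂ L)
classSums {k} []       = sumF-zero k
classSums ((c′ , x) ∷ L) = trans (sumF-+ (indicator c′ x) (λ c → classSum c L))
  (cong₂ _+_ (sumF-indicator c′ x) (classSums L))

tagged : ∀ {m} → (ℚ → ℚ) → List (Item m) → List (Fin m × ℚ)
tagged g = map (λ e → colour e , g (size e))

classSum-tagged : ∀ {m} (g : ℚ → ℚ) c (I : List (Item m)) →
  classSum c (tagged g I) ≡ sumℚ (map (g ∘ size) (colourClass c I))
classSum-tagged g c [] = refl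
classSum-tagged g c (e ∷ I) with does (colour e ≟ c)
... | true  = cong (g (size e) +_) (classSum-tagged g c I)
... | false = trans (+-identityˡ _) (classSum-tagged g c I)

-- `binLoad` runs over all items and puts 0 for those outside the bin. As `g` vanishes at 0, this
-- padded list has the same `g`-sum as the contents of the bin, and summing over the bins gives the
-- total.
packing-bound : ∀ {m k} (I : List (Item m)) (g : ℚ → ℚ) n → g 0ℚ ≡ 0ℚ →
  (∀ xs → All (0ℚ ≤_) xs → sumℚ xs ≤ 1ℚ → sumℚ (map g xs) ≤ ι n) →
  All (λ e → 0ℚ ≤ size e) I → Packable k I → sumℚ (map (g ∘ size) I) ≤ ι (n ℕ.* k)
packing-bound {m} {k} I g n g0 bound sizes≥0 (f , fit) = subst (_≤ ι (n ℕ.* k)) total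
  (sumF-≤ (λ b → classSum b (assigned is)) n λ b →
    subst (_≤ ι n) (contents is b) (bound _ (nonneg b is) (fit b)))
  where
  is = allFin (length I)
  s : Fin (length I) → ℚ
  s i = size (lookup I i)
  assigned : List (Fin (length I)) → List (Fin k × ℚ)
  assigned = map (λ i → f i , g (s i))
  inBin : Fin k → Fin (length I) → ℚ
  inBin b i = if does (f i ≟ b) then s i else 0ℚ
  contents : ∀ L b → sumℚ (map g (map (inBin b) L)) ≡ classSum b (assigned L)
  contents []      b = refl
  contents (i ∷ L) b with does (f i ≟ b)
  ... | true  = cong (g (s i) +_) (contents L b)
  ... | false = cong₂ _+_ g0 (contents L b)
  nonneg : ∀ b L → All (0ℚ ≤_) (map (inBin b) L)
  nonneg b [] = []
  nonneg b (i ∷ L) with does (f i ≟ b)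
  ... | true  = All.lookup sizes≥0 (∈-lookup i) ∷ nonneg b L
  ... | false = ≤-refl ∷ nonneg b L
  total : sumF (λ b → classSum b (assigned is)) ≡ sumℚ (map (g ∘ size) I)
  total = trans (classSums (assigned is)) (cong sumℚ (trans (sym (map-∘ is))
    (trans (map-∘ is) (cong (map (g ∘ size)) (trans (map-tabulate (λ i → i) (lookup I)) (tabulate-lookup I))))))

weight-0 : weight 0ℚ ≡ 0ℚ
weight-0 = linear (bonus 0ℚ ∷ []) (λ b → b ≼ # 0 ⇒ # 0 ≼ b ⇒ ⊢ 12 · # 0 ⊕ b ≈ # 0)
  (bonus-tiny 0ℚ (linear [] (⊢ 6 · # 0 ≼ # 1))) (bonus-≥0 0ℚ)

packing-weight : ∀ {m k} (I : List (Item m)) → All (λ e → 0ℚ ≤ size e) I → Packable k I →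
  sumℚ (map (weight ∘ size) I) ≤ ι (17 ℕ.* k)
packing-weight I = packing-bound I weight 17 weight-0 weights-≤17

packing-size : ∀ {m k} (I : List (Item m)) → All (λ e → 0ℚ ≤ size e) I → Packable k I →
  sumℚ (map size I) ≤ ι k
packing-size {k = k} I ps pack = subst (λ n → sumℚ (map size I) ≤ ι n) (ℕ.*-identityˡ k)
  (packing-bound I (λ x → x) 1 refl (λ xs _ h → subst (λ ys → sumℚ ys ≤ 1ℚ) (sym (map-id xs)) h) ps pack)

-- One colour

regionSize-suc : ∀ j l → regionSize j (suc l) ≡ ι 2 * regionSize j l
regionSize-suc j l = trans (cong (_* eps j) (ι-* 2 (2 ^ l))) (*-assoc (ι 2) (pow2 l) (eps j))

pow2*eps : ∀ j → pow2 j * eps j ≡ 1ℚ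
pow2*eps zero    = refl
pow2*eps (suc j) = trans (cong (_* (½ * eps j)) (ι-* 2 (2 ^ j)))
  (trans (solve 4 (λ a p h e → (a :* p) :* (h :* e) := (a :* h) :* (p :* e)) refl (ι 2) (pow2 j) ½ (eps j))
    (trans (*-identityˡ _) (pow2*eps j)))

eps-≥0 : ∀ j → 0ℚ ≤ eps j
eps-≥0 zero    = linear [] (⊢ # 0 ≼ # 1)
eps-≥0 (suc j) = *-monoˡ-≤-nonNeg ½ (eps-≥0 j)

regions-fill-bin : ∀ j l → l ℕ.≤ j → ι (regionsPerBin j l) * regionSize j l ≡ 1ℚ
regions-fill-bin j l l≤j = trans (sym (*-assoc (ι (2 ^ (j ∸ l))) (pow2 l) (eps j)))
  (trans (cong (_* eps j) (trans (sym (ι-* (2 ^ (j ∸ l)) (2 ^ l)))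
    (cong ι (trans (sym (ℕ.^-distribˡ-+-* 2 (j ∸ l) l)) (cong (2 ^_) (ℕ.m∸n+n≡m l≤j)))))) (pow2*eps j))

Regions : Set
Regions = List (ℕ × ℚ)

capacity : ℕ → Regions → ℚ
capacity j V = sumℚ (map (regionSize j ∘ proj₁) V)

capacity-insert : ∀ j α l s β → capacity j (α ++ (l , s) ∷ β) ≡ regionSize j l + capacity j (α ++ β)
capacity-insert j []            l s β = refl
capacity-insert j ((k , t) ∷ α) l s β =
  linear (regionSize j k ∷ regionSize j l ∷ capacity j (α ++ β) ∷ capacity j (α ++ (l , s) ∷ β) ∷ [])
    (λ a b c d → d ≈ b ⊕ c ⇒ ⊢ a ⊕ d ≈ b ⊕ (a ⊕ c)) (capacity-insert j α l s β)

insert-All : ∀ {A : Set} {P : A → Set} {x} α {β} → P x → All P (α ++ β) → All P (α ++ x ∷ β)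
insert-All []      px ps       = px ∷ ps
insert-All (_ ∷ α) px (p ∷ ps) = p ∷ insert-All α px ps

delete-All : ∀ {A : Set} {P : A → Set} {x} α {β} → All P (α ++ x ∷ β) → P x × All P (α ++ β)
delete-All []      (px ∷ ps) = px , ps
delete-All (_ ∷ α) (p ∷ ps) with delete-All α ps
... | px , qs = px , p ∷ qs

-- Moves and accounts of one colour

data Target (j : ℕ) (V : Regions) (s : ℚ) (l : ℕ) : Set where
  up    : ∀ α i ℓ β → V ≡ α ++ (i , ℓ) ∷ β → All (λ r → proj₁ r ℕ.≤ i) V →
    ¬ (ℓ + s ≤ regionSize j i) → LeastLevel j (suc i) s l → Target j V s l
  first : All (λ r → proj₁ r ℕ.≤ 0) V → LeastLevel j 1 s l → Target j V s l

-- What a step does to the regions V, the loads O of the open isolated bins and the loads K of the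
-- closed isolated bins of the colour of the packed item.
data Move (j : ℕ) (s : ℚ) (V : Regions) (O K : List ℚ) : Regions → List ℚ → List ℚ → Set where
  fits : O ≡ [] → K ≡ [] → ∀ α i ℓ β → V ≡ α ++ (i , ℓ) ∷ β → All (λ r → proj₁ r ℕ.≤ i) V →
    Move j s V O K (α ++ (i , ℓ + s) ∷ β) O K
  place : O ≡ [] → K ≡ [] → ∀ {l} → Target j V s l → l ℕ.< j → ∀ α β → V ≡ α ++ β →
    Move j s V O K (α ++ (l , s) ∷ β) O K
  isolate : O ≡ [] → K ≡ [] → Target j V s j → Move j s V O K V (O ++ s ∷ []) K
  bestFit : ∀ α ℓ β → O ≡ α ++ ℓ ∷ β → ℓ + s ≤ 1ℚ →
    All (λ ℓ′ → ℓ′ + s ≤ 1ℚ → ℓ′ ≤ ℓ) (α ++ β) → Move j s V O K V (α ++ (ℓ + s) ∷ β) K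
  openNew : ¬ (O ≡ [] × K ≡ []) → All (λ ℓ → ¬ (ℓ + s ≤ 1ℚ)) O → length O ℕ.< 2 →
    Move j s V O K V (O ++ s ∷ []) K
  closeAndOpen : ∀ α ℓ β K′ → O ≡ α ++ ℓ ∷ β → All (λ ℓ → ¬ (ℓ + s ≤ 1ℚ)) O → 2 ℕ.≤ length O →
    All (_≤ ℓ) (α ++ β) → length K′ ≡ suc (length K) → Move j s V O K V (α ++ β ++ s ∷ []) K′

-- S and W are the total size and ten times the total weight packed so far. For the factor 3, the
-- capacity of all regions but the top one must also be covered: this pays for a region of the next level.
data Account (j : ℕ) (V : Regions) (O K : List ℚ) (S W : ℚ) : Set where
  unseen : V ≡ [] → O ≡ [] → K ≡ [] → 0ℚ ≤ S → 0ℚ ≤ W → Account j V O K S W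
  shared : O ≡ [] → K ≡ [] → ∀ α i ℓ β S₀ → V ≡ α ++ (i , ℓ) ∷ β → 1 ℕ.≤ i → i ℕ.< j →
    All (λ r → proj₁ r ℕ.< i) (α ++ β) → length V ℕ.≤ i →
    capacity j (α ++ β) ≤ ι 3 * S₀ → capacity j V ≤ ι 3 * (S₀ + ℓ) →
    S₀ + ℓ ≤ S → 0ℚ ≤ W → Account j V O K S W
  single : ∀ p S₀ → O ≡ p ∷ [] → K ≡ [] → 0ℚ ≤ p → length V ℕ.< j →
    capacity j V ≤ ι 3 * S₀ → capacity j V + 1ℚ ≤ ι 3 * (S₀ + p) →
    S₀ + p ≤ S → ι 12 * p ≤ W → Account j V O K S W
  double : ∀ p q S₀ → O ≡ p ∷ q ∷ [] → 0ℚ ≤ p → 0ℚ ≤ q → length V ℕ.< j →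
    capacity j V + ι (length K) ≤ ι 3 * S₀ → S₀ + (p + q) ≤ S → 1ℚ < p + q →
    Ledger p q (ι (length K)) W → Account j V O K S W

-- The situation just before a region of level `l` is opened, common to a first item and to a move
-- up. Levels rise strictly and start at 1, whence `length<l`; this is the source of the logarithm
-- in the bound for one colour.
record Room (j : ℕ) (V : Regions) (S W s : ℚ) (l : ℕ) : Set where
  field
    covered      : ℚ
    covered≤S    : covered ≤ S
    0≤W          : 0ℚ ≤ W
    capacity≤    : capacity j V ≤ ι 3 * covered
    capacity-new : capacity j V + regionSize j l ≤ ι 3 * (covered + s)
    levels<l     : All (λ r → proj₁ r ℕ.< l) V
    length<l     : length V ℕ.< l
    1≤l          : 1 ℕ.≤ l

-- If a level was skipped, the one just below `l` was too small for the item, and region sizes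
-- double from level to level.
least-level-half : ∀ j {lo s l} → LeastLevel j lo s l → eps j ≤ s →
  l ≡ lo ⊎ regionSize j l ≤ ι 2 * s
least-level-half j {lo} {s} {zero}  (lo≤l , _ , below) ε≤s = inj₁ (sym (ℕ.n≤0⇒n≡0 lo≤l))
least-level-half j {lo} {s} {suc l} (lo≤l , _ , below) ε≤s with ℕ.m≤n⇒m<n∨m≡n lo≤l
... | inj₂ lo≡l = inj₁ (sym lo≡l)
... | inj₁ (ℕ.s≤s lo≤l) = inj₂ (linear (regionSize j (suc l) ∷ regionSize j l ∷ s ∷ [])
  (λ r′ r s → r′ ≈ 2 · r ⇒ r ≺ s ⇒ ⊢ r′ ≼ 2 · s) (regionSize-suc j l) (below l lo≤l ℕ.≤-refl))

-- An account and a move each single out a topmost region. All other regions lie strictly below it,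
-- so the two decompositions coincide once `top-level` has identified the levels.
top-unique : ∀ {i : ℕ} {ℓ ℓ′ : ℚ} α {β} α′ {β′} → All (λ r → proj₁ r ℕ.< i) (α ++ β) →
  α ++ (i , ℓ) ∷ β ≡ α′ ++ (i , ℓ′) ∷ β′ → α ≡ α′ × ℓ ≡ ℓ′ × β ≡ β′
top-unique []      []       ps refl = refl , refl , refl
top-unique []      (_ ∷ α′) ps refl = ⊥-elim (ℕ.<-irrefl refl (proj₁ (delete-All α′ ps)))
top-unique (_ ∷ α) []       (p ∷ ps) refl = ⊥-elim (ℕ.<-irrefl refl p)
top-unique (_ ∷ α) (_ ∷ α′) (p ∷ ps) eq with ∷-injective eq
... | refl , eq′ with top-unique α α′ ps eq′
...   | refl , refl , refl = refl , refl , refl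

top-level : ∀ {i i′ : ℕ} {ℓ ℓ′ : ℚ} α {β} α′ {β′} → All (λ r → proj₁ r ℕ.< i) (α ++ β) →
  α ++ (i , ℓ) ∷ β ≡ α′ ++ (i′ , ℓ′) ∷ β′ → All (λ r → proj₁ r ℕ.≤ i′) (α ++ (i , ℓ) ∷ β) → i ≡ i′
top-level α α′ ps eq qs = ℕ.≤-antisym (proj₁ (delete-All α qs))
  (proj₁ (delete-All α′ (subst (All _) eq (insert-All α ℕ.≤-refl (All.map ℕ.<⇒≤ ps)))))

[]≢insert : ∀ {A : Set} α {x : A} {β} → [] ≢ α ++ x ∷ β
[]≢insert []      ()
[]≢insert (_ ∷ _) ()

private
  -- Even with no level skipped a first item fills half of its region: level 1 has size twice the
  -- lower bound on item sizes.
  half-first : ∀ j {s l} → LeastLevel j 1 s l → eps j ≤ s → regionSize j l ≤ ι 2 * s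
  half-first j {s} ll ε≤s with least-level-half j ll ε≤s
  ... | inj₂ h    = h
  ... | inj₁ refl = linear (regionSize j 1 ∷ regionSize j 0 ∷ eps j ∷ s ∷ [])
    (λ r₁ r₀ e s → r₁ ≈ 2 · r₀ ⇒ r₀ ≈ e ⇒ e ≼ s ⇒ ⊢ r₁ ≼ 2 · s)
    (regionSize-suc j 0) (*-identityˡ (eps j)) ε≤s

room : ∀ {j V O K S W s l} → Account j V O K S W → O ≡ [] → Target j V s l → eps j ≤ s → Room j V S W s l
room (single p S₀ refl _ _ _ _ _ _ _)  () _ _
room (double p q S₀ refl _ _ _ _ _ _ _) () _ _
room (unseen refl _ _ 0≤S 0≤W) _ (up α i ℓ β eq _ _ _) ε≤s = ⊥-elim ([]≢insert α eq)
room {j} {s = s} {l} (unseen refl _ _ 0≤S 0≤W) _ (first _ ll) ε≤s = record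
  { covered = 0ℚ ; covered≤S = 0≤S ; 0≤W = 0≤W ; capacity≤ = linear [] (⊢ # 0 ≼ 3 · # 0)
  ; capacity-new = linear (regionSize j l ∷ s ∷ eps j ∷ [])
      (λ r s e → r ≼ 2 · s ⇒ # 0 ≼ e ⇒ e ≼ s ⇒ ⊢ # 0 ⊕ r ≼ 3 · (# 0 ⊕ s)) (half-first j ll ε≤s) (eps-≥0 j) ε≤s
  ; levels<l = [] ; length<l = proj₁ ll ; 1≤l = proj₁ ll }
-- `levelOf` is 0 for a colour not yet packed, whereas every shared account has its top region at
-- level 1 or higher.
room (shared _ _ α i ℓ β S₀ refl 1≤i _ _ _ _ _ _ _) _ (first low _) _ =
  ⊥-elim (ℕ.<⇒≱ 1≤i (proj₁ (delete-All α low)))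
room {j} {V} {s = s} {l} (shared _ _ α i ℓ β S₀ refl 1≤i i<j lower len cap cap′ S≥ 0≤W) _
  (up α′ i′ ℓ′ β′ eq highest full ll) ε≤s with top-level α α′ lower eq highest
... | refl with top-unique α α′ lower eq
...   | refl , refl , refl = record
  { covered = S₀ + ℓ ; covered≤S = S≥ ; 0≤W = 0≤W ; capacity≤ = cap′
  ; capacity-new = new (least-level-half j ll ε≤s)
  ; levels<l = All.map (λ h → ℕ.≤-<-trans h (proj₁ ll)) highest
  ; length<l = ℕ.≤-<-trans len (proj₁ ll) ; 1≤l = ℕ.≤-trans (ℕ.s≤s ℕ.z≤n) (proj₁ ll) }
  where
  new : l ≡ suc i ⊎ regionSize j l ≤ ι 2 * s → capacity j V + regionSize j l ≤ ι 3 * (S₀ + ℓ + s)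
  new (inj₂ h) = linear (capacity j V ∷ regionSize j l ∷ S₀ ∷ ℓ ∷ s ∷ eps j ∷ [])
    (λ c r S ℓ s e → c ≼ 3 · (S ⊕ ℓ) ⇒ r ≼ 2 · s ⇒ # 0 ≼ e ⇒ e ≼ s ⇒ ⊢ c ⊕ r ≼ 3 · (S ⊕ ℓ ⊕ s))
    cap′ h (eps-≥0 j) ε≤s
  -- The item alone may be far too small to pay for the new region. The bound `cap`, which omits the
  -- old top region of size r, leaves all of 3(ℓ + s) for r + 2r.
  new (inj₁ refl) =
    linear (capacity j V ∷ regionSize j (suc i) ∷ regionSize j i ∷ capacity j (α ++ β) ∷ S₀ ∷ ℓ ∷ s ∷ [])
      (λ c r′ r c₀ S ℓ s → c ≈ r ⊕ c₀ ⇒ r′ ≈ 2 · r ⇒ c₀ ≼ 3 · S ⇒ r ≺ ℓ ⊕ s ⇒ ⊢ c ⊕ r′ ≼ 3 · (S ⊕ ℓ ⊕ s))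
      (capacity-insert j α i ℓ β) (regionSize-suc j i) cap (≰⇒> full)

account-move : ∀ {j V O K V′ O′ K′ S W s} → Account j V O K S W → Move j s V O K V′ O′ K′ → eps j ≤ s →
  Account j V′ O′ K′ (S + s) (W + weight s)
account-move {j} {V} {O} {K} {V′} {O′} {K′} {S} {W} {s} acc mv ε≤s = update acc mv
  where
  0≤s : 0ℚ ≤ s
  0≤s = ≤-trans (eps-≥0 j) ε≤s

  W-grows : 0ℚ ≤ W → 0ℚ ≤ W + weight s
  W-grows = linear (W ∷ s ∷ bonus s ∷ []) (λ W s b → # 0 ≼ s ⇒ # 0 ≼ b ⇒ # 0 ≼ W ⇒ ⊢ # 0 ≼ W ⊕ (12 · s ⊕ b))
    0≤s (bonus-≥0 s)

  add-choice : ∀ {ℓ ℓ′} → (ℓ′ + s ≤ 1ℚ → ℓ′ ≤ ℓ) → 1ℚ < ℓ′ + s ⊎ ℓ′ ≤ ℓ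
  add-choice {ℓ} {ℓ′} h = cases (ℓ′ + s ≤? 1ℚ)
    where
    cases : Dec (ℓ′ + s ≤ 1ℚ) → 1ℚ < ℓ′ + s ⊎ ℓ′ ≤ ℓ
    cases (yes f) = inj₂ (h f)
    cases (no ¬f) = inj₁ (≰⇒> ¬f)

  grown : ∀ {p} → 0ℚ ≤ p → 0ℚ ≤ p + s
  grown {p} = linear (p ∷ s ∷ []) (λ p s → # 0 ≼ s ⇒ # 0 ≼ p ⇒ ⊢ # 0 ≼ p ⊕ s) 0≤s

  new-region : ∀ {l} α β → Account j V O K S W → O ≡ [] → K ≡ [] → Target j V s l → l ℕ.< j → V ≡ α ++ β →
    Account j (α ++ (l , s) ∷ β) O K (S + s) (W + weight s)
  new-region {l} α β acc O≡ K≡ tgt l<j refl = shared O≡ K≡ α l s β covered refl 1≤l l<j levels<l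
    (ℕ.≤-trans (ℕ.≤-reflexive (length-++-sucʳ α _ β)) length<l) capacity≤
    (linear (capacity j (α ++ (l , s) ∷ β) ∷ capacity j (α ++ β) ∷ regionSize j l ∷ covered ∷ s ∷ [])
      (λ c′ c r S s → c′ ≈ r ⊕ c ⇒ c ⊕ r ≼ 3 · (S ⊕ s) ⇒ ⊢ c′ ≼ 3 · (S ⊕ s))
      (capacity-insert j α l s β) capacity-new)
    (linear (covered ∷ S ∷ s ∷ []) (λ c S s → c ≼ S ⇒ ⊢ c ⊕ s ≼ S ⊕ s) covered≤S)
    (W-grows 0≤W)
    where open Room (room acc O≡ tgt ε≤s)

  first-isolated : Account j V O K S W → O ≡ [] → K ≡ [] → Target j V s j →
    Account j V (O ++ s ∷ []) K (S + s) (W + weight s)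
  first-isolated acc refl K≡ tgt = single s covered refl K≡ 0≤s length<l capacity≤
    -- A bin of level j is a single region of size 1, so the first isolated bin is paid for like any
    -- other region.
    (linear (capacity j V ∷ regionSize j j ∷ covered ∷ s ∷ [])
      (λ c r S s → r ≈ # 1 ⇒ c ⊕ r ≼ 3 · (S ⊕ s) ⇒ ⊢ c ⊕ # 1 ≼ 3 · (S ⊕ s)) (pow2*eps j) capacity-new)
    (linear (covered ∷ S ∷ s ∷ []) (λ c S s → c ≼ S ⇒ ⊢ c ⊕ s ≼ S ⊕ s) covered≤S)
    (linear (W ∷ s ∷ bonus s ∷ []) (λ W s b → # 0 ≼ W ⇒ # 0 ≼ b ⇒ ⊢ 12 · s ≼ W ⊕ (12 · s ⊕ b)) 0≤W (bonus-≥0 s))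
    where open Room (room acc refl tgt ε≤s)

  update : Account j V O K S W → Move j s V O K V′ O′ K′ → Account j V′ O′ K′ (S + s) (W + weight s)
  update (unseen refl _ _ _ _) (fits _ _ α i ℓ β eq _) = ⊥-elim ([]≢insert α eq)
  update (single p S₀ refl _ _ _ _ _ _ _)   (fits () _ _ _ _ _ _ _)
  update (double p q S₀ refl _ _ _ _ _ _ _) (fits () _ _ _ _ _ _ _)
  update (shared O≡ K≡ α i ℓ β S₀ refl 1≤i i<j lower len cap cap′ S≥ 0≤W) (fits _ _ α′ i′ ℓ′ β′ eq highest)
    with top-level α α′ lower eq highest
  ... | refl with top-unique α α′ lower eq
  ...   | refl , refl , refl = shared O≡ K≡ α i (ℓ + s) β S₀ refl 1≤i i<j lower
    (ℕ.≤-trans (ℕ.≤-reflexive (trans (length-++-sucʳ α _ β) (sym (length-++-sucʳ α _ β)))) len) cap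
    (linear (capacity j (α ++ (i , ℓ + s) ∷ β) ∷ capacity j (α ++ (i , ℓ) ∷ β) ∷ regionSize j i ∷
        capacity j (α ++ β) ∷ S₀ ∷ ℓ ∷ s ∷ [])
      (λ c′ c r c₀ S ℓ s → c′ ≈ r ⊕ c₀ ⇒ c ≈ r ⊕ c₀ ⇒ c ≼ 3 · (S ⊕ ℓ) ⇒ # 0 ≼ s ⇒ ⊢ c′ ≼ 3 · (S ⊕ (ℓ ⊕ s)))
      (capacity-insert j α i (ℓ + s) β) (capacity-insert j α i ℓ β) cap′ 0≤s)
    (linear (S₀ ∷ ℓ ∷ S ∷ s ∷ []) (λ S₀ ℓ S s → S₀ ⊕ ℓ ≼ S ⇒ ⊢ S₀ ⊕ (ℓ ⊕ s) ≼ S ⊕ s) S≥)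
    (W-grows 0≤W)
  update acc (place O≡ K≡ tgt l<j α β eq) = new-region α β acc O≡ K≡ tgt l<j eq
  update acc (isolate O≡ K≡ tgt) = first-isolated acc O≡ K≡ tgt
  update (unseen _ refl _ _ _) (bestFit α ℓ β eq _ _) = ⊥-elim ([]≢insert α eq)
  update (shared refl _ _ _ _ _ _ _ _ _ _ _ _ _ _ _) (bestFit α ℓ β eq _ _) = ⊥-elim ([]≢insert α eq)
  update (single p S₀ refl K≡ 0≤p len cap cap′ S≥ W≥) (bestFit [] ℓ β refl _ _) =
    single (p + s) S₀ refl K≡ (grown 0≤p) len cap
      (linear (capacity j V ∷ S₀ ∷ p ∷ s ∷ []) (λ c S p s → # 0 ≼ s ⇒ c ⊕ # 1 ≼ 3 · (S ⊕ p) ⇒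
        ⊢ c ⊕ # 1 ≼ 3 · (S ⊕ (p ⊕ s))) 0≤s cap′)
      (linear (S₀ ∷ p ∷ S ∷ s ∷ []) (λ S₀ ℓ S s → S₀ ⊕ ℓ ≼ S ⇒ ⊢ S₀ ⊕ (ℓ ⊕ s) ≼ S ⊕ s) S≥)
      (linear (W ∷ p ∷ s ∷ bonus s ∷ []) (λ W p s b → 12 · p ≼ W ⇒ # 0 ≼ b ⇒
        ⊢ 12 · (p ⊕ s) ≼ W ⊕ (12 · s ⊕ b)) W≥ (bonus-≥0 s))
  update (single p S₀ refl _ _ _ _ _ _ _) (bestFit (_ ∷ α) ℓ β eq _ _) = ⊥-elim ([]≢insert α (proj₂ (∷-injective eq)))
  update (double p q S₀ refl 0≤p 0≤q len cap S≥ pq led) (bestFit [] ℓ β refl _ (h ∷ [])) =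
    double (p + s) q S₀ refl (grown 0≤p) 0≤q len cap
      (linear (S₀ ∷ p ∷ q ∷ S ∷ s ∷ []) (λ S₀ p q S s → S₀ ⊕ (p ⊕ q) ≼ S ⇒ ⊢ S₀ ⊕ (p ⊕ s ⊕ q) ≼ S ⊕ s) S≥)
      (linear (p ∷ q ∷ s ∷ []) (λ p q s → # 1 ≺ p ⊕ q ⇒ # 0 ≼ s ⇒ ⊢ # 1 ≺ p ⊕ s ⊕ q) pq 0≤s)
      (add-older s led 0≤s pq (add-choice h))
  update (double p q S₀ refl 0≤p 0≤q len cap S≥ pq led) (bestFit (_ ∷ []) ℓ β refl _ (h ∷ [])) =
    double p (q + s) S₀ refl 0≤p (grown 0≤q) len cap
      (linear (S₀ ∷ p ∷ q ∷ S ∷ s ∷ []) (λ S₀ p q S s → S₀ ⊕ (p ⊕ q) ≼ S ⇒ ⊢ S₀ ⊕ (p ⊕ (q ⊕ s)) ≼ S ⊕ s) S≥)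
      (linear (p ∷ q ∷ s ∷ []) (λ p q s → # 1 ≺ p ⊕ q ⇒ # 0 ≼ s ⇒ ⊢ # 1 ≺ p ⊕ (q ⊕ s)) pq 0≤s)
      (add-newer s led 0≤s pq (add-choice h))
  update (double p q S₀ refl _ _ _ _ _ _ _) (bestFit (_ ∷ _ ∷ α) ℓ β eq _ _) =
    ⊥-elim ([]≢insert α (proj₂ (∷-injective (proj₂ (∷-injective eq)))))
  update (unseen _ refl refl _ _) (openNew ne _ _) = ⊥-elim (ne (refl , refl))
  update (shared refl refl _ _ _ _ _ _ _ _ _ _ _ _ _ _) (openNew ne _ _) = ⊥-elim (ne (refl , refl))
  update (double p q S₀ refl _ _ _ _ _ _ _) (openNew _ _ few) = ⊥-elim (ℕ.<-irrefl refl few)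
  update (single p S₀ refl refl 0≤p len cap cap′ S≥ W≥) (openNew _ (h ∷ []) _) =
    double p s S₀ refl 0≤p 0≤s len
      (linear (capacity j V ∷ S₀ ∷ []) (λ c S → c ≼ 3 · S ⇒ ⊢ c ⊕ # 0 ≼ 3 · S) cap)
      (linear (S₀ ∷ p ∷ S ∷ s ∷ []) (λ S₀ ℓ S s → S₀ ⊕ ℓ ≼ S ⇒ ⊢ S₀ ⊕ (ℓ ⊕ s) ≼ S ⊕ s) S≥)
      (≰⇒> h)
      (open-second s (linear (W ∷ p ∷ []) (λ W p → 12 · p ≼ W ⇒ ⊢ 10 · # 0 ⊕ 12 · p ≼ W) W≥))
  update (unseen _ refl _ _ _) (closeAndOpen α ℓ β _ eq _ _ _ _) = ⊥-elim ([]≢insert α eq)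
  update (shared refl _ _ _ _ _ _ _ _ _ _ _ _ _ _ _) (closeAndOpen α ℓ β _ eq _ _ _ _) = ⊥-elim ([]≢insert α eq)
  update (single p S₀ refl _ _ _ _ _ _ _) (closeAndOpen _ _ _ _ _ _ (ℕ.s≤s ()) _ _)
  update (double p q S₀ refl _ _ _ _ _ _ _) (closeAndOpen (_ ∷ _ ∷ α) ℓ β _ eq _ _ _ _) =
    ⊥-elim ([]≢insert α (proj₂ (∷-injective (proj₂ (∷-injective eq)))))
  -- New bins are appended, so the position in the list is the age. The fuller of two loads with sum
  -- above 1 exceeds 1/2; moved into `S₀`, it pays for its closed bin.
  update (double p q S₀ refl 0≤p 0≤q len cap S≥ pq led) (closeAndOpen [] ℓ β K′ refl (_ ∷ h ∷ []) _ (q≤p ∷ []) k) =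
    double q s (S₀ + p) refl 0≤q 0≤s len
      (linear (capacity j V ∷ ι (length K) ∷ ι (length K′) ∷ S₀ ∷ p ∷ q ∷ []) (λ c k k′ S p q → k′ ≈ # 1 ⊕ k ⇒
        c ⊕ k ≼ 3 · S ⇒ # 1 ≺ p ⊕ q ⇒ q ≼ p ⇒ ⊢ c ⊕ k′ ≼ 3 · (S ⊕ p)) k′ cap pq q≤p)
      (linear (S₀ ∷ p ∷ q ∷ S ∷ s ∷ []) (λ S₀ p q S s → S₀ ⊕ (p ⊕ q) ≼ S ⇒ ⊢ S₀ ⊕ p ⊕ (q ⊕ s) ≼ S ⊕ s) S≥)
      (≰⇒> h)
      (subst (λ N → Ledger q s N (W + weight s)) (sym k′) (close-older s led pq q≤p (≰⇒> h)))
    where k′ = trans (cong ι k) (ι-suc (length K))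
  update (double p q S₀ refl 0≤p 0≤q len cap S≥ pq led) (closeAndOpen (_ ∷ []) ℓ β K′ refl (h ∷ _ ∷ []) _ (p≤q ∷ []) k) =
    double p s (S₀ + q) refl 0≤p 0≤s len
      (linear (capacity j V ∷ ι (length K) ∷ ι (length K′) ∷ S₀ ∷ p ∷ q ∷ []) (λ c k k′ S p q → k′ ≈ # 1 ⊕ k ⇒
        c ⊕ k ≼ 3 · S ⇒ # 1 ≺ p ⊕ q ⇒ p ≼ q ⇒ ⊢ c ⊕ k′ ≼ 3 · (S ⊕ q)) k′ cap pq p≤q)
      (linear (S₀ ∷ p ∷ q ∷ S ∷ s ∷ []) (λ S₀ p q S s → S₀ ⊕ (p ⊕ q) ≼ S ⇒ ⊢ S₀ ⊕ q ⊕ (p ⊕ s) ≼ S ⊕ s) S≥)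
      (≰⇒> h)
      (subst (λ N → Ledger p s N (W + weight s)) (sym k′) (close-newer s led pq p≤q (≰⇒> h)))
    where k′ = trans (cong ι k) (ι-suc (length K))

-- Bounds read off from an account

bins-≤-size : ∀ {j V O K S W} → Account j V O K S W →
  capacity j V + (ι (length O) + ι (length K)) ≤ ι 3 * S
bins-≤-size {S = S} (unseen refl refl refl 0≤S _) =
  linear (S ∷ []) (λ S → # 0 ≼ S ⇒ ⊢ # 0 ⊕ (# 0 ⊕ # 0) ≼ 3 · S) 0≤S
bins-≤-size {j} {V} {S = S} (shared refl refl α i ℓ β S₀ _ _ _ _ _ _ cap′ S≥ _) =
  linear (capacity j V ∷ S₀ ∷ ℓ ∷ S ∷ []) (λ c S₀ ℓ S → c ≼ 3 · (S₀ ⊕ ℓ) ⇒ S₀ ⊕ ℓ ≼ S ⇒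
    ⊢ c ⊕ (# 0 ⊕ # 0) ≼ 3 · S) cap′ S≥
bins-≤-size {j} {V} {S = S} (single p S₀ refl refl _ _ _ cap′ S≥ _) =
  linear (capacity j V ∷ S₀ ∷ p ∷ S ∷ []) (λ c S₀ ℓ S → c ⊕ # 1 ≼ 3 · (S₀ ⊕ ℓ) ⇒ S₀ ⊕ ℓ ≼ S ⇒
    ⊢ c ⊕ (# 1 ⊕ # 0) ≼ 3 · S) cap′ S≥
bins-≤-size {j} {V} {K = K} {S = S} (double p q S₀ refl _ _ _ cap S≥ pq _) =
  linear (capacity j V ∷ S₀ ∷ p ∷ q ∷ S ∷ ι (length K) ∷ []) (λ c S₀ p q S k → c ⊕ k ≼ 3 · S₀ ⇒
    S₀ ⊕ (p ⊕ q) ≼ S ⇒ # 1 ≺ p ⊕ q ⇒ ⊢ c ⊕ (# 2 ⊕ k) ≼ 3 · S) cap S≥ pq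

-- The 30 consists of 20 for the two open bins and 10 for the loan.
isolated-≤-weight : ∀ {j V O K S W} → Account j V O K S W → ι 10 * (ι (length O) + ι (length K)) ≤ ι 30 + W
isolated-≤-weight {W = W} (unseen _ refl refl _ 0≤W) =
  linear (W ∷ []) (λ W → # 0 ≼ W ⇒ ⊢ 10 · (# 0 ⊕ # 0) ≼ # 30 ⊕ W) 0≤W
isolated-≤-weight {W = W} (shared refl refl _ _ _ _ _ _ _ _ _ _ _ _ _ 0≤W) =
  linear (W ∷ []) (λ W → # 0 ≼ W ⇒ ⊢ 10 · (# 0 ⊕ # 0) ≼ # 30 ⊕ W) 0≤W
isolated-≤-weight {W = W} (single p _ refl refl 0≤p _ _ _ _ W≥) =
  linear (W ∷ p ∷ []) (λ W p → # 0 ≼ p ⇒ 12 · p ≼ W ⇒ ⊢ 10 · (# 1 ⊕ # 0) ≼ # 30 ⊕ W) 0≤p W≥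
isolated-≤-weight {K = K} {W = W} (double p q _ refl 0≤p 0≤q _ _ _ _ led) =
  linear (W ∷ ι (length K) ∷ []) (λ W k → 10 · k ≼ # 10 ⊕ W ⇒ ⊢ 10 · (# 2 ⊕ k) ≼ # 30 ⊕ W)
    (closed-bound led 0≤p 0≤q)

regions-≤-level : ∀ {j V O K S W} → Account j V O K S W → length V ℕ.≤ j
regions-≤-level (unseen refl _ _ _ _) = ℕ.z≤n
regions-≤-level (shared _ _ _ _ _ _ _ _ _ i<j _ len _ _ _ _) = ℕ.≤-trans len (ℕ.<⇒≤ i<j)
regions-≤-level (single _ _ _ _ _ len _ _ _ _) = ℕ.<⇒≤ len
regions-≤-level (double _ _ _ _ _ _ len _ _ _ _) = ℕ.<⇒≤ len

open-≤2 : ∀ {j V O K S W} → Account j V O K S W → length O ℕ.≤ 2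
open-≤2 (unseen _ refl _ _ _) = ℕ.z≤n
open-≤2 (shared refl _ _ _ _ _ _ _ _ _ _ _ _ _ _ _) = ℕ.z≤n
open-≤2 (single _ _ refl _ _ _ _ _ _ _) = ℕ.s≤s ℕ.z≤n
open-≤2 (double _ _ _ refl _ _ _ _ _ _ _) = ℕ.≤-refl

-- The bins as seen by one colour

module _ {A B : Set} (f : A → List B) where

  concatMap-focus : ∀ pre {b} post {α γ} → f b ≡ α ++ γ →
    concatMap f (pre ++ b ∷ post) ≡ (concatMap f pre ++ α) ++ (γ ++ concatMap f post)
  concatMap-focus pre {b} post {α} {γ} eq = begin
    concatMap f (pre ++ b ∷ post)                          ≡⟨ concatMap-++ f pre (b ∷ post) ⟩
    concatMap f pre ++ (f b ++ concatMap f post)           ≡⟨ cong (λ z → concatMap f pre ++ (z ++ concatMap f post)) eq ⟩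
    concatMap f pre ++ ((α ++ γ) ++ concatMap f post)      ≡⟨ cong (concatMap f pre ++_) (++-assoc α γ _) ⟩
    concatMap f pre ++ (α ++ (γ ++ concatMap f post))      ≡⟨ ++-assoc (concatMap f pre) α _ ⟨
    (concatMap f pre ++ α) ++ (γ ++ concatMap f post)      ∎
    where open ≡-Reasoning

  concatMap-mid : ∀ pre {b} post {γ} → f b ≡ γ → concatMap f (pre ++ b ∷ post) ≡ concatMap f pre ++ (γ ++ concatMap f post)
  concatMap-mid pre {b} post refl = concatMap-++ f pre (b ∷ post)

  concatMap-replace : ∀ pre {b b′} post → f b ≡ f b′ → concatMap f (pre ++ b ∷ post) ≡ concatMap f (pre ++ b′ ∷ post)
  concatMap-replace pre {b} {b′} post eq = trans (concatMap-mid pre post eq) (sym (concatMap-++ f pre (b′ ∷ post)))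

  concatMap-snoc : ∀ bs b {γ} → f b ≡ γ → concatMap f (bs ++ b ∷ []) ≡ concatMap f bs ++ γ
  concatMap-snoc bs b refl = trans (concatMap-++ f bs (b ∷ [])) (cong (concatMap f bs ++_) (++-identityʳ (f b)))

  concatMap-snoc-[] : ∀ bs b → f b ≡ [] → concatMap f (bs ++ b ∷ []) ≡ concatMap f bs
  concatMap-snoc-[] bs b eq = trans (concatMap-snoc bs b eq) (++-identityʳ _)

module _ {m : ℕ} (c : Fin m) where

  pick : {A : Set} → Fin m → A → List A
  pick c′ a = if does (c′ ≟ c) then a ∷ [] else []

  pick-own : ∀ {A : Set} (a : A) → pick c a ≡ a ∷ []
  pick-own a rewrite dec-true (c ≟ c) refl = refl

  pick-other : ∀ {A : Set} {c′} → c′ ≢ c → (a : A) → pick c′ a ≡ []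
  pick-other {c′ = c′} c′≢c a rewrite dec-false (c′ ≟ c) c′≢c = refl

  shareOf : ℕ → Fin m × ℚ → Regions
  shareOf l r = pick (proj₁ r) (l , proj₂ r)

  sharesIn : Bin m → Regions
  sharesIn (nonIso l rs) = concatMap (shareOf l) rs
  sharesIn (iso _ _ _)   = []

  openIn : Bin m → List ℚ
  openIn (nonIso _ _)     = []
  openIn (iso c′ ℓ true)  = pick c′ ℓ
  openIn (iso c′ ℓ false) = []

  closedIn : Bin m → List ℚ
  closedIn (nonIso _ _)     = []
  closedIn (iso c′ ℓ true)  = []
  closedIn (iso c′ ℓ false) = pick c′ ℓ

  shares : List (Bin m) → Regions
  shares = concatMap sharesIn

  opens closeds : List (Bin m) → List ℚ
  opens   = concatMap openIn
  closeds = concatMap closedIn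

  shares-own-region : ∀ i rpre ℓ rpost →
    sharesIn (nonIso i (rpre ++ (c , ℓ) ∷ rpost)) ≡
    concatMap (shareOf i) rpre ++ (i , ℓ) ∷ concatMap (shareOf i) rpost
  shares-own-region i rpre ℓ rpost = concatMap-mid (shareOf i) rpre rpost (pick-own (i , ℓ))

  level-bound : ∀ l rs → All (λ r → proj₁ r ℕ.≤ l) (concatMap (shareOf l) rs)
  level-bound l [] = []
  level-bound l ((c′ , ℓ) ∷ rs) with does (c′ ≟ c)
  ... | true  = ℕ.≤-refl ∷ level-bound l rs
  ... | false = level-bound l rs

  shares-≤-levelOf : ∀ bs → All (λ r → proj₁ r ℕ.≤ levelOf c bs) (shares bs)
  shares-≤-levelOf []                = []
  shares-≤-levelOf (iso _ _ _ ∷ bs)  = shares-≤-levelOf bs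
  shares-≤-levelOf (nonIso l rs ∷ bs) = All.++⁺
    (All.map (λ h → ℕ.≤-trans h (ℕ.m≤m⊔n _ _)) (inBin rs))
    (All.map (λ h → ℕ.≤-trans h (ℕ.m≤n⊔m _ (levelOf c bs))) (shares-≤-levelOf bs))
    where
    inBin : ∀ rs → All (λ r → proj₁ r ℕ.≤ (if containsᵇ c (nonIso l rs) then l else 0)) (concatMap (shareOf l) rs)
    inBin [] = []
    inBin ((c′ , ℓ) ∷ rs) with does (c′ ≟ c)
    ... | true  = ℕ.≤-refl ∷ level-bound l rs
    ... | false = inBin rs

  shares-≤ : ∀ bs {i} → levelOf c bs ≡ i → All (λ r → proj₁ r ℕ.≤ i) (shares bs)
  shares-≤ bs refl = shares-≤-levelOf bs

  not-isolated : ∀ bs → isIsoᵇ c bs ≡ false → opens bs ≡ [] × closeds bs ≡ []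
  not-isolated [] h = refl , refl
  not-isolated (nonIso _ _ ∷ bs) h = not-isolated bs h
  not-isolated (iso c′ ℓ true ∷ bs) h with does (c′ ≟ c)
  ... | false = not-isolated bs h
  not-isolated (iso c′ ℓ false ∷ bs) h with does (c′ ≟ c)
  ... | false = not-isolated bs h

  isolated : ∀ bs → isIsoᵇ c bs ≡ true → ¬ (opens bs ≡ [] × closeds bs ≡ [])
  isolated (nonIso _ _ ∷ bs) h = isolated bs h
  isolated (iso c′ ℓ true ∷ bs) h with does (c′ ≟ c)
  ... | false = isolated bs h
  ... | true  = λ ()
  isolated (iso c′ ℓ false ∷ bs) h with does (c′ ≟ c)
  ... | false = isolated bs h
  ... | true  = λ ()

  openIsoCount≡ : ∀ bs → openIsoCount c bs ≡ length (opens bs)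
  openIsoCount≡ []                     = refl
  openIsoCount≡ (nonIso _ _ ∷ bs)      = openIsoCount≡ bs
  openIsoCount≡ (iso c′ _ false ∷ bs)  = openIsoCount≡ bs
  openIsoCount≡ (iso c′ _ true ∷ bs) with does (c′ ≟ c)
  ... | true  = cong suc (openIsoCount≡ bs)
  ... | false = openIsoCount≡ bs

  All-opens : ∀ {P : ℚ → Set} {Q : Bin m → Set} → (∀ b → Q b → ∀ ℓ → b ≡ iso c ℓ true → P ℓ) →
    ∀ {bs} → All Q bs → All P (opens bs)
  All-opens {P} h = concatMap-All λ b q → inBin b (h b q)
    where
    inBin : ∀ b → (∀ ℓ → b ≡ iso c ℓ true → P ℓ) → All P (openIn b)
    inBin (nonIso _ _)     h = []
    inBin (iso _ _ false)  h = []
    inBin (iso c′ ℓ true)  h with c′ ≟ c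
    ... | yes refl = h ℓ refl ∷ []
    ... | no  _    = []

  private
    retarget : ∀ {j s V O K V′ O′ K′ V″ O″ K″} → V″ ≡ V′ → O″ ≡ O′ → K″ ≡ K′ →
      Move j s V O K V′ O′ K′ → Move j s V O K V″ O″ K″
    retarget refl refl refl mv = mv

  place-own : ∀ {j s l bs bs′} → PlaceNew j c s l bs bs′ → opens bs ≡ [] → closeds bs ≡ [] →
    Target j (shares bs) s l →
    Move j s (shares bs) (opens bs) (closeds bs) (shares bs′) (opens bs′) (closeds bs′)
  place-own {s = s} {l} (existing pre rs post l<j _) O≡ K≡ tgt = retarget
    (concatMap-mid sharesIn pre post (cong (_++ concatMap (shareOf l) rs) (pick-own (l , s))))
    (concatMap-replace openIn pre post refl) (concatMap-replace closedIn pre post refl)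
    (place O≡ K≡ tgt l<j (shares pre) (concatMap (shareOf l) rs ++ shares post) (concatMap-mid sharesIn pre post refl))
  place-own {s = s} {l} (fresh bs l<j _) O≡ K≡ tgt = retarget
    (concatMap-snoc sharesIn bs _ (cong (_++ []) (pick-own (l , s))))
    (concatMap-snoc-[] openIn bs _ refl) (concatMap-snoc-[] closedIn bs _ refl)
    (place O≡ K≡ tgt l<j (shares bs) [] (sym (++-identityʳ _)))
  place-own {s = s} {l} (top bs refl) O≡ K≡ tgt = retarget
    (concatMap-snoc-[] sharesIn bs _ refl) (concatMap-snoc openIn bs _ (pick-own s))
    (concatMap-snoc-[] closedIn bs _ refl)
    (isolate O≡ K≡ tgt)

  step-own : ∀ {j s bs bs′} → isIsoᵇ c bs ≡ false × MNFStep j c s bs bs′ ⊎ isIsoᵇ c bs ≡ true × BBFStep c s bs bs′ →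
    Move j s (shares bs) (opens bs) (closeds bs) (shares bs′) (opens bs′) (closeds bs′)
  step-own {s = s} {bs} (inj₁ (h , fits i pre rpre ℓ rpost post level _)) = retarget
    (concatMap-focus sharesIn pre post (shares-own-region i rpre (ℓ + s) rpost))
    (concatMap-replace openIn pre post refl) (concatMap-replace closedIn pre post refl)
    (fits (proj₁ (not-isolated bs h)) (proj₂ (not-isolated bs h)) _ _ ℓ _
      (concatMap-focus sharesIn pre post (shares-own-region i rpre ℓ rpost)) (shares-≤ bs level))
  step-own {bs = bs} (inj₁ (h , moveUp i pre rpre ℓ rpost post l bs′ level full ll new)) =
    place-own new (proj₁ (not-isolated bs h)) (proj₂ (not-isolated bs h))
      (up _ _ ℓ _ (concatMap-focus sharesIn pre post (shares-own-region i rpre ℓ rpost)) (shares-≤ bs level) full ll)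
  step-own {bs = bs} (inj₁ (h , first .bs l bs′ level0 ll new)) =
    place-own new (proj₁ (not-isolated bs h)) (proj₂ (not-isolated bs h))
      (first (shares-≤ bs level0) ll)
  step-own {s = s} (inj₂ (h , bestFit pre ℓ post fit best)) = retarget
    (concatMap-replace sharesIn pre post refl)
    (concatMap-mid openIn pre post (pick-own (ℓ + s)))
    (concatMap-replace closedIn pre post refl)
    (bestFit (opens pre) ℓ (opens post) (concatMap-mid openIn pre post (pick-own ℓ)) fit
      (subst (All _) (concatMap-++ openIn pre post) (All-opens (λ b q ℓ′ eq → q ℓ′ eq) best)))
  step-own {s = s} (inj₂ (h , openNew bs full few)) = retarget
    (concatMap-snoc-[] sharesIn bs _ refl) (concatMap-snoc openIn bs _ (pick-own s))
    (concatMap-snoc-[] closedIn bs _ refl)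
    (openNew (isolated bs h) (All-opens (λ b q ℓ′ eq → q ℓ′ eq) full) (subst (ℕ._< 2) (openIsoCount≡ bs) few))
  step-own {s = s} (inj₂ (h , closeAndOpen pre ℓ post full many fullest)) = retarget
    (trans (concatMap-mid sharesIn pre (post ++ iso c s true ∷ []) refl)
      (trans (cong (shares pre ++_) (concatMap-snoc-[] sharesIn post _ refl)) (sym (concatMap-++ sharesIn pre _))))
    (trans (concatMap-mid openIn pre (post ++ iso c s true ∷ []) refl)
      (cong (opens pre ++_) (concatMap-snoc openIn post _ (pick-own s))))
    refl
    (closeAndOpen (opens pre) ℓ (opens post) _ (concatMap-mid openIn pre post (pick-own ℓ))
      (All-opens (λ b q ℓ′ eq → q ℓ′ eq) full) (subst (ℕ._≥ 2) (openIsoCount≡ (pre ++ iso c ℓ true ∷ post)) many)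
      (subst (All _) (concatMap-++ openIn pre post) (All-opens (λ b q ℓ′ eq → q ℓ′ eq) fullest))
      -- The closed bin keeps its place among all bins, so it enters `closeds` somewhere in the
      -- middle; `Move` therefore records only that the length grows by one.
      (trans (cong length (trans (concatMap-mid closedIn pre (post ++ iso c s true ∷ []) (pick-own ℓ))
          (cong (λ z → closeds pre ++ ℓ ∷ z) (concatMap-snoc-[] closedIn post _ refl))))
        (trans (length-++-sucʳ (closeds pre) ℓ (closeds post))
          (cong (suc ∘ length) (sym (concatMap-++ closedIn pre (iso c ℓ true ∷ post)))))))

  record Unchanged (bs bs′ : List (Bin m)) : Set where
    constructor unchanged
    field
      shares≡  : shares bs′ ≡ shares bs
      opens≡   : opens bs′ ≡ opens bs
      closeds≡ : closeds bs′ ≡ closeds bs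

  private
    replace-bin : ∀ pre {b b′} post → sharesIn b′ ≡ sharesIn b → openIn b′ ≡ openIn b → closedIn b′ ≡ closedIn b →
      Unchanged (pre ++ b ∷ post) (pre ++ b′ ∷ post)
    replace-bin pre post V≡ O≡ K≡ = unchanged (concatMap-replace sharesIn pre post V≡)
      (concatMap-replace openIn pre post O≡) (concatMap-replace closedIn pre post K≡)

    append-bin : ∀ bs b → sharesIn b ≡ [] → openIn b ≡ [] → closedIn b ≡ [] → Unchanged bs (bs ++ b ∷ [])
    append-bin bs b V≡ O≡ K≡ = unchanged (concatMap-snoc-[] sharesIn bs b V≡)
      (concatMap-snoc-[] openIn bs b O≡) (concatMap-snoc-[] closedIn bs b K≡)

    both : ∀ {bs bs′ bs″} → Unchanged bs bs′ → Unchanged bs′ bs″ → Unchanged bs bs″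
    both (unchanged a b c) (unchanged d e f) = unchanged (trans d a) (trans e b) (trans f c)

  module _ {c′ : Fin m} (other : c′ ≢ c) where

    place-other : ∀ {j s l bs bs′} → PlaceNew j c′ s l bs bs′ → Unchanged bs bs′
    place-other {s = s} {l} (existing pre rs post _ _) =
      replace-bin pre post (cong (_++ concatMap (shareOf l) rs) (pick-other other (l , s))) refl refl
    place-other {s = s} {l} (fresh bs _ _) =
      append-bin bs _ (cong (_++ []) (pick-other other (l , s))) refl refl
    place-other {s = s} (top bs _) = append-bin bs _ refl (pick-other other s) refl

    MNF-other : ∀ {j s bs bs′} → MNFStep j c′ s bs bs′ → Unchanged bs bs′
    MNF-other {s = s} (fits i pre rpre ℓ rpost post _ _) = replace-bin pre post
      (concatMap-replace (shareOf i) rpre rpost (trans (pick-other other (i , ℓ + s)) (sym (pick-other other (i , ℓ)))))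
      refl refl
    MNF-other (moveUp _ _ _ _ _ _ _ _ _ _ _ new) = place-other new
    MNF-other (first _ _ _ _ _ new) = place-other new

    BBF-other : ∀ {s bs bs′} → BBFStep c′ s bs bs′ → Unchanged bs bs′
    BBF-other {s} (bestFit pre ℓ post _ _) = replace-bin pre post refl
      (trans (pick-other other (ℓ + s)) (sym (pick-other other ℓ))) refl
    BBF-other {s} (openNew bs _ _) = append-bin bs _ refl (pick-other other s) refl
    -- Closing and opening are treated as two successive changes, each invisible to the colour `c`.
    BBF-other {s} (closeAndOpen pre ℓ post _ _ _) = both
      (replace-bin pre post refl (sym (pick-other other ℓ)) (pick-other other ℓ))
      (subst (Unchanged (pre ++ iso c′ ℓ false ∷ post)) (++-assoc pre (iso c′ ℓ false ∷ post) _)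
        (append-bin (pre ++ iso c′ ℓ false ∷ post) (iso c′ s true) refl (pick-other other s) refl))

  -- The summands `0ℚ` are what `indicator` contributes for an item of another colour, as
  -- `account-step` requires.
  account-unchanged : ∀ {j bs bs′ S W} → Unchanged bs bs′ → Account j (shares bs) (opens bs) (closeds bs) S W →
    Account j (shares bs′) (opens bs′) (closeds bs′) (S + 0ℚ) (W + 0ℚ)
  account-unchanged {S = S} {W} (unchanged V≡ O≡ K≡) acc
    rewrite V≡ | O≡ | K≡ | +-identityʳ S | +-identityʳ W = acc

  account-step : ∀ {j bs bs′ S W} e → Account j (shares bs) (opens bs) (closeds bs) S W → eps j ≤ size e →
    Step j bs e bs′ → Account j (shares bs′) (opens bs′) (closeds bs′)
      (S + indicator (colour e) (size e) c) (W + indicator (colour e) (weight (size e)) c)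
  account-step (item s c′) acc ε≤s st with c′ ≟ c | st
  ... | yes refl | viaMNF _ h mv = account-move acc (step-own (inj₁ (h , mv))) ε≤s
  ... | yes refl | viaBBF _ h mv = account-move acc (step-own (inj₂ (h , mv))) ε≤s
  ... | no other | viaMNF _ h mv = account-unchanged (MNF-other other mv) acc
  ... | no other | viaBBF _ h mv = account-unchanged (BBF-other other mv) acc

  account-run : ∀ {j bs B S W} I → Account j (shares bs) (opens bs) (closeds bs) S W → ValidInstance j I →
    Run j bs I B → Account j (shares B) (opens B) (closeds B)
      (S + classSum c (tagged (λ x → x) I)) (W + classSum c (tagged weight I))
  account-run {S = S} {W} [] acc [] (done _) rewrite +-identityʳ S | +-identityʳ W = acc
  account-run {S = S} {W} (e ∷ I) acc ((ε≤s , _) ∷ valid) (step _ _ st run) =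
    subst₂ (Account _ _ _ _) (+-assoc S _ _) (+-assoc W _ _)
      (account-run I (account-step e acc ε≤s st) valid run)

  account : ∀ {j I B} → ValidInstance j I → Run j [] I B → Account j (shares B) (opens B) (closeds B)
    (classSum c (tagged (λ x → x) I)) (classSum c (tagged weight I))
  account {I = I} valid run = subst₂ (Account _ _ _ _) (+-identityˡ _) (+-identityˡ _)
    (account-run I (unseen refl refl refl ≤-refl ≤-refl) valid run)

-- Unused regions

-- A non-isolated bin of level l with k used regions is recorded as (l , k).
Shape : Set
Shape = List (ℕ × ℕ)

module _ {m : ℕ} where

  shapeOf : Bin m → Shape
  shapeOf (nonIso l rs) = (l , length rs) ∷ []
  shapeOf (iso _ _ _)   = []

  shape : List (Bin m) → Shape
  shape = concatMap shapeOf

spare : ℕ → ℕ × ℕ → ℕ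
spare j (l , k) = if does (k ℕ.<? regionsPerBin j l) then 1 else 0

spareAt : ℕ → ℕ → ℕ × ℕ → ℕ
spareAt j n x = if does (proj₁ x ℕ.≟ n) then spare j x else 0

record WellShaped (j : ℕ) (A : Shape) : Set where
  field
    used     : All (λ x → proj₁ x ℕ.< j × 1 ℕ.≤ proj₂ x) A
    spareAt≤1 : ∀ n → sum (map (spareAt j n) A) ℕ.≤ 1

data Grow (j : ℕ) (A : Shape) : Shape → Set where
  same   : Grow j A A
  extend : ∀ α l k β → A ≡ α ++ (l , k) ∷ β → Grow j A (α ++ (l , suc k) ∷ β)
  new    : ∀ l → l ℕ.< j → All (λ x → ¬ (proj₁ x ≡ l × proj₂ x ℕ.< regionsPerBin j l)) A →
    Grow j A (A ++ (l , 1) ∷ [])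

sum-map-++ : ∀ {A : Set} (f : A → ℕ) xs ys → sum (map f (xs ++ ys)) ≡ sum (map f xs) ℕ.+ sum (map f ys)
sum-map-++ f xs ys = trans (cong sum (map-++ f xs ys)) (sum-++ (map f xs) (map f ys))

spare≤1 : ∀ j x → spare j x ℕ.≤ 1
spare≤1 j (l , k) with does (k ℕ.<? regionsPerBin j l)
... | true  = ℕ.≤-refl
... | false = ℕ.z≤n

spare-suc : ∀ j l k → spare j (l , suc k) ℕ.≤ spare j (l , k)
spare-suc j l k with k ℕ.<? regionsPerBin j l
... | yes k< rewrite dec-true (k ℕ.<? regionsPerBin j l) k< = spare≤1 j (l , suc k)
... | no  k≮ rewrite dec-false (suc k ℕ.<? regionsPerBin j l) (k≮ ∘ ℕ.<-trans ℕ.≤-refl) = ℕ.z≤n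

spareAt-suc : ∀ j n l k → spareAt j n (l , suc k) ℕ.≤ spareAt j n (l , k)
spareAt-suc j n l k with does (l ℕ.≟ n)
... | true  = spare-suc j l k
... | false = ℕ.z≤n

spareAt-none : ∀ j l {A} → All (λ x → ¬ (proj₁ x ≡ l × proj₂ x ℕ.< regionsPerBin j l)) A →
  sum (map (spareAt j l) A) ≡ 0
spareAt-none j l [] = refl
spareAt-none j l {(l′ , k) ∷ A} (h ∷ hs) with l′ ℕ.≟ l
... | no  l′≢l rewrite dec-false (l′ ℕ.≟ l) l′≢l = spareAt-none j l hs
... | yes refl rewrite dec-true (l ℕ.≟ l) refl | dec-false (k ℕ.<? regionsPerBin j l) (λ k< → h (refl , k<)) = spareAt-none j l hs

-- A bin is added to a level only when no bin of that level has a spare region, and using a region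
-- of an existing bin cannot create a spare one.
grow-well-shaped : ∀ {j A A′} → WellShaped j A → Grow j A A′ → WellShaped j A′
grow-well-shaped ws same = ws
grow-well-shaped {j} ws (extend α l k β refl) = record
  { used = insert-All α (proj₁ (proj₁ parts) , ℕ.s≤s ℕ.z≤n) (proj₂ parts)
  ; spareAt≤1 = λ n → ℕ.≤-trans (shrink n) (spareAt≤1 n) }
  where
  open WellShaped ws
  parts = delete-All α used
  shrink : ∀ n → sum (map (spareAt j n) (α ++ (l , suc k) ∷ β)) ℕ.≤ sum (map (spareAt j n) (α ++ (l , k) ∷ β))
  shrink n rewrite sum-map-++ (spareAt j n) α ((l , suc k) ∷ β) | sum-map-++ (spareAt j n) α ((l , k) ∷ β) =
    ℕ.+-monoʳ-≤ (sum (map (spareAt j n) α)) (ℕ.+-monoˡ-≤ (sum (map (spareAt j n) β)) (spareAt-suc j n l k))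
grow-well-shaped {j} {A} ws (new l l<j none) = record
  { used = All.++⁺ used ((l<j , ℕ.≤-refl) ∷ []) ; spareAt≤1 = bound }
  where
  open WellShaped ws
  bound : ∀ n → sum (map (spareAt j n) (A ++ (l , 1) ∷ [])) ℕ.≤ 1
  bound n rewrite sum-map-++ (spareAt j n) A ((l , 1) ∷ []) with l ℕ.≟ n
  ... | no  l≢n  rewrite dec-false (l ℕ.≟ n) l≢n | ℕ.+-identityʳ (sum (map (spareAt j n) A)) = spareAt≤1 n
  ... | yes refl rewrite dec-true (l ℕ.≟ l) refl | spareAt-none j l none | ℕ.+-identityʳ (spare j (l , 1)) = spare≤1 j (l , 1)

-- The sum of `spareAt` over the levels below `n`. Exchanging the sums over levels and bins turns
-- the bound 1 per level into the bound j for all bins.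
spareBelow : ℕ → ℕ → ℕ × ℕ → ℕ
spareBelow j zero    x = 0
spareBelow j (suc n) x = spareAt j n x ℕ.+ spareBelow j n x

spare≤spareBelow : ∀ j n l k → l ℕ.< n → spare j (l , k) ℕ.≤ spareBelow j n (l , k)
spare≤spareBelow j (suc n) l k (ℕ.s≤s l≤n) with ℕ.m≤n⇒m<n∨m≡n l≤n
... | inj₁ l<n  = ℕ.≤-trans (spare≤spareBelow j n l k l<n) (ℕ.m≤n+m _ (spareAt j n (l , k)))
... | inj₂ refl rewrite dec-true (n ℕ.≟ n) refl = ℕ.m≤m+n (spare j (n , k)) _

sum-map-+ : ∀ {A : Set} (f g : A → ℕ) xs → sum (map (λ x → f x ℕ.+ g x) xs) ≡ sum (map f xs) ℕ.+ sum (map g xs)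
sum-map-+ f g []       = refl
sum-map-+ f g (x ∷ xs) rewrite sum-map-+ f g xs = interchange (f x) (g x) _ _

spares-≤-levels : ∀ {j A} → WellShaped j A → sum (map (spare j) A) ℕ.≤ j
spares-≤-levels {j} {A} ws = ℕ.≤-trans (below used) (atMost j)
  where
  open WellShaped ws
  below : ∀ {A} → All (λ x → proj₁ x ℕ.< j × 1 ℕ.≤ proj₂ x) A → sum (map (spare j) A) ℕ.≤ sum (map (spareBelow j j) A)
  below []                 = ℕ.z≤n
  below ((l<j , _) ∷ rest) = ℕ.+-mono-≤ (spare≤spareBelow j j _ _ l<j) (below rest)
  atMost : ∀ n → sum (map (spareBelow j n) A) ℕ.≤ n
  atMost zero = ℕ.≤-reflexive (zeros A)
    where
    zeros : ∀ A → sum (map (spareBelow j 0) A) ≡ 0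
    zeros []      = refl
    zeros (_ ∷ A) = zeros A
  atMost (suc n) rewrite sum-map-+ (spareAt j n) (spareBelow j n) A = ℕ.+-mono-≤ (spareAt≤1 n) (atMost n)

module _ {m : ℕ} where

  private
    regrow : ∀ {j A A′ A″} → A″ ≡ A′ → Grow j A A′ → Grow j A A″
    regrow refl g = g

    keep : ∀ {j A A′} → A′ ≡ A → Grow j A A′
    keep refl = same

  place-shape : ∀ {j s l} {c : Fin m} {bs bs′} → PlaceNew j c s l bs bs′ → Grow j (shape bs) (shape bs′)
  place-shape {l = l} (existing pre rs post _ _) = regrow (concatMap-mid shapeOf pre post refl)
    (extend (shape pre) l (length rs) (shape post) (concatMap-mid shapeOf pre post refl))
  place-shape {l = l} (fresh bs l<j none) = regrow (concatMap-snoc shapeOf bs _ refl)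
    (new l l<j (concatMap-All inBin none))
    where
    inBin : ∀ b → ¬ HasFreeRegion _ l b → All (λ x → ¬ (proj₁ x ≡ l × proj₂ x ℕ.< regionsPerBin _ l)) (shapeOf b)
    inBin (nonIso _ _) h = h ∷ []
    inBin (iso _ _ _)  h = []
  place-shape (top bs _) = keep (concatMap-snoc-[] shapeOf bs _ refl)

  step-shape : ∀ {j bs e bs′} → Step {m} j bs e bs′ → Grow j (shape bs) (shape bs′)
  step-shape (viaMNF _ _ (fits i pre rpre ℓ rpost post _ _)) = keep (concatMap-replace shapeOf pre post
    (cong (λ n → (i , n) ∷ []) (trans (length-++-sucʳ rpre _ rpost) (sym (length-++-sucʳ rpre _ rpost)))))
  step-shape (viaMNF _ _ (moveUp _ _ _ _ _ _ _ _ _ _ _ p)) = place-shape p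
  step-shape (viaMNF _ _ (first _ _ _ _ _ p)) = place-shape p
  step-shape (viaBBF _ _ (bestFit pre ℓ post _ _)) = keep (concatMap-replace shapeOf pre post refl)
  step-shape (viaBBF _ _ (openNew bs _ _)) = keep (concatMap-snoc-[] shapeOf bs _ refl)
  step-shape (viaBBF _ _ (closeAndOpen pre ℓ post _ _ _)) = keep
    (trans (concatMap-mid shapeOf pre _ refl)
      (trans (cong (shape pre ++_) (concatMap-snoc-[] shapeOf post _ refl)) (sym (concatMap-mid shapeOf pre post refl))))

  run-well-shaped : ∀ {j bs I B} → WellShaped j (shape bs) → Run {m} j bs I B → WellShaped j (shape B)
  run-well-shaped ws (done _)          = ws
  run-well-shaped ws (step _ _ st run) = run-well-shaped (grow-well-shaped ws (step-shape st)) run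

  well-shaped : ∀ {j I B} → Run {m} j [] I B → WellShaped j (shape B)
  well-shaped = run-well-shaped (record { used = [] ; spareAt≤1 = λ _ → ℕ.z≤n })

-- Counting bins

sumℚ-++ : ∀ xs ys → sumℚ (xs ++ ys) ≡ sumℚ xs + sumℚ ys
sumℚ-++ []       ys = sym (+-identityˡ _)
sumℚ-++ (x ∷ xs) ys = trans (cong (x +_) (sumℚ-++ xs ys)) (sym (+-assoc x _ _))

sum-const : ∀ {A : Set} (x : ℚ) n → x ≡ ι n → ∀ (L : List A) → sumℚ (map (λ _ → x) L) ≡ ι (n ℕ.* length L)
sum-const x n eq []      = cong ι (sym (ℕ.*-zeroʳ n))
sum-const x n eq (_ ∷ L) = trans (cong₂ _+_ eq (sum-const x n eq L))
  (trans (sym (ι-+ n (n ℕ.* length L))) (cong ι (sym (ℕ.*-suc n (length L)))))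

count≡ : ∀ {A : Set} (L : List A) → sumℚ (map (λ _ → 1ℚ) L) ≡ ι (length L)
count≡ L = trans (sum-const 1ℚ 1 refl L) (cong ι (ℕ.*-identityˡ (length L)))

module _ {m : ℕ} (w : ℕ → ℚ) (u v : ℚ) where

  -- Prices per region, per open and per closed isolated bin. With `regionSize j`, 1, 1 they measure
  -- reserved capacity; with 1, 1, 0 they bound the number of open bins.
  charge : Regions → List ℚ → List ℚ → ℚ
  charge V O K = sumℚ (map (w ∘ proj₁) V) + (sumℚ (map (λ _ → u) O) + sumℚ (map (λ _ → v) K))

  charge-++ : ∀ V O K V′ O′ K′ → charge (V ++ V′) (O ++ O′) (K ++ K′) ≡ charge V O K + charge V′ O′ K′
  charge-++ V O K V′ O′ K′ =
    linear (a ∷ b ∷ c ∷ a′ ∷ b′ ∷ c′ ∷ sumℚ (map (w ∘ proj₁) (V ++ V′)) ∷ sumℚ (map (λ _ → u) (O ++ O′)) ∷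
        sumℚ (map (λ _ → v) (K ++ K′)) ∷ [])
      (λ a b c a′ b′ c′ A B C → A ≈ a ⊕ a′ ⇒ B ≈ b ⊕ b′ ⇒ C ≈ c ⊕ c′ ⇒
        ⊢ A ⊕ (B ⊕ C) ≈ (a ⊕ (b ⊕ c)) ⊕ (a′ ⊕ (b′ ⊕ c′)))
      (split-sum _ V V′) (split-sum _ O O′) (split-sum _ K K′)
    where
    split-sum : ∀ {A : Set} (f : A → ℚ) xs ys → sumℚ (map f (xs ++ ys)) ≡ sumℚ (map f xs) + sumℚ (map f ys)
    split-sum f xs ys = trans (cong sumℚ (map-++ f xs ys)) (sumℚ-++ (map f xs) (map f ys))
    a = sumℚ (map (w ∘ proj₁) V)
    b = sumℚ (map (λ _ → u) O)
    c = sumℚ (map (λ _ → v) K)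
    a′ = sumℚ (map (w ∘ proj₁) V′)
    b′ = sumℚ (map (λ _ → u) O′)
    c′ = sumℚ (map (λ _ → v) K′)

  binCharge : Bin m → ℚ
  binCharge (nonIso l rs)   = sumℚ (map (λ _ → w l) rs)
  binCharge (iso _ _ true)  = u
  binCharge (iso _ _ false) = v

  colourCharge : List (Bin m) → Fin m → ℚ
  colourCharge bs c = charge (shares c bs) (opens c bs) (closeds c bs)

  private
    region-charge : ∀ l rs → sumF (λ c → charge (sharesIn c (nonIso l rs)) [] []) ≡ binCharge (nonIso l rs)
    region-charge l []              = sumF-zero m
    region-charge l ((c′ , ℓ) ∷ rs) = trans
      (sumF-cong λ c → trans (charge-++ (shareOf c l (c′ , ℓ)) [] [] (sharesIn c (nonIso l rs)) [] [])
        (cong (_+ charge (sharesIn c (nonIso l rs)) [] []) (one c)))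
      (trans (sumF-+ (indicator c′ (w l)) _) (cong₂ _+_ (sumF-indicator c′ (w l)) (region-charge l rs)))
      where
      one : ∀ c → charge (shareOf c l (c′ , ℓ)) [] [] ≡ indicator c′ (w l) c
      one c with does (c′ ≟ c)
      ... | true  = linear (w l ∷ []) (λ w → ⊢ (w ⊕ # 0) ⊕ (# 0 ⊕ # 0) ≈ w)
      ... | false = refl

    bin-charge : ∀ b → sumF (λ c → charge (sharesIn c b) (openIn c b) (closedIn c b)) ≡ binCharge b
    bin-charge (nonIso l rs)    = region-charge l rs
    bin-charge (iso c′ ℓ true)  = trans (sumF-cong one) (sumF-indicator c′ u)
      where
      one : ∀ c → charge [] (openIn c (iso c′ ℓ true)) [] ≡ indicator c′ u c
      one c with does (c′ ≟ c)
      ... | true  = linear (u ∷ []) (λ u → ⊢ # 0 ⊕ ((u ⊕ # 0) ⊕ # 0) ≈ u)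
      ... | false = refl
    bin-charge (iso c′ ℓ false) = trans (sumF-cong one) (sumF-indicator c′ v)
      where
      one : ∀ c → charge [] [] (closedIn c (iso c′ ℓ false)) ≡ indicator c′ v c
      one c with does (c′ ≟ c)
      ... | true  = linear (v ∷ []) (λ v → ⊢ # 0 ⊕ (# 0 ⊕ (v ⊕ # 0)) ≈ v)
      ... | false = refl

  -- Double counting: each region and each isolated bin is seen by exactly one colour. This carries
  -- the bounds per colour over to the whole packing.
  total-charge : ∀ bs → sumℚ (map binCharge bs) ≡ sumF (colourCharge bs)
  total-charge []       = sym (sumF-zero m)
  total-charge (b ∷ bs) = sym (trans
    (sumF-cong λ c → charge-++ (sharesIn c b) (openIn c b) (closedIn c b) (shares c bs) (opens c bs) (closeds c bs))
    (trans (sumF-+ (λ c → charge (sharesIn c b) (openIn c b) (closedIn c b)) (colourCharge bs))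
      (cong₂ _+_ (bin-charge b) (sym (total-charge bs)))))

sizes-≥0 : ∀ {m} j {I : List (Item m)} → ValidInstance j I → All (λ e → 0ℚ ≤ size e) I
sizes-≥0 j = All.map λ h → ≤-trans (eps-≥0 j) (proj₁ h)

module _ {m : ℕ} (j : ℕ) where

  private
    region-volume : ∀ {A : Set} l (rs : List A) → sumℚ (map (λ _ → regionSize j l) rs) ≡ ι (length rs) * regionSize j l
    region-volume l []       = sym (*-zeroˡ (regionSize j l))
    region-volume l (_ ∷ rs) = trans (cong (r +_) (region-volume l rs))
      (trans (cong (_+ ι (length rs) * r) (sym (*-identityˡ r))) (trans (sym (*-distribʳ-+ r 1ℚ (ι (length rs))))
        (cong (_* r) (sym (ι-suc (length rs))))))
      where
      r = regionSize j l

    regionSize-≥0 : ∀ l → 0ℚ ≤ regionSize j l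
    regionSize-≥0 l = nonNegative⁻¹ (regionSize j l)
      {{nonNeg*nonNeg⇒nonNeg (pow2 l) {{nonNegative (ι-≥0 (2 ^ l))}} (eps j) {{nonNegative (eps-≥0 j)}}}}

    volume-≥0 : ∀ {A : Set} l (rs : List A) → 0ℚ ≤ sumℚ (map (λ _ → regionSize j l) rs)
    volume-≥0 l []       = ≤-refl
    volume-≥0 l (_ ∷ rs) = +-mono-≤ (regionSize-≥0 l) (volume-≥0 l rs)

    full : ∀ l n → l ℕ.≤ j → regionsPerBin j l ℕ.≤ n → 1ℚ ≤ ι n * regionSize j l
    full l n l≤j many = subst (_≤ ι n * regionSize j l) (regions-fill-bin j l l≤j)
      (*-monoʳ-≤-nonNeg (regionSize j l) {{nonNegative (regionSize-≥0 l)}} (ι-mono many))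

    -- If all regions are in use, their sizes add up to at least the capacity of the bin; otherwise
    -- the counter `spare` supplies the 1.
    spare-or-full : ∀ {A : Set} l (rs : List A) → l ℕ.≤ j →
      1ℚ ≤ sumℚ (map (λ _ → regionSize j l) rs) + ι (spare j (l , length rs))
    spare-or-full l rs l≤j = cases (length rs ℕ.<? regionsPerBin j l)
      where
      volume = sumℚ (map (λ _ → regionSize j l) rs)
      cases : Dec (length rs ℕ.< regionsPerBin j l) → 1ℚ ≤ volume + ι (spare j (l , length rs))
      cases (yes few) = linear (volume ∷ ι (spare j (l , length rs)) ∷ [])
        (λ x y → # 0 ≼ x ⇒ y ≈ # 1 ⇒ ⊢ # 1 ≼ x ⊕ y) (volume-≥0 l rs)
        (cong (λ b → ι (if b then 1 else 0)) (dec-true (length rs ℕ.<? regionsPerBin j l) few))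
      cases (no many) = linear (volume ∷ ι (spare j (l , length rs)) ∷ ι (length rs) * regionSize j l ∷ [])
        (λ x y z → x ≈ z ⇒ # 1 ≼ z ⇒ # 0 ≼ y ⇒ ⊢ # 1 ≼ x ⊕ y) (region-volume l rs)
        (full l (length rs) l≤j (ℕ.≮⇒≥ many)) (ι-≥0 (spare j (l , length rs)))

  private
    cost : Bin m → ℚ
    cost = binCharge (regionSize j) 1ℚ 1ℚ

    count-isolated : ∀ (bs : List (Bin m)) → ι (length bs) ≤ sumℚ (map cost bs) + ι (sum (map (spare j) (shape bs))) →
      ι (suc (length bs)) ≤ 1ℚ + sumℚ (map cost bs) + ι (sum (map (spare j) (shape bs)))
    count-isolated bs = linear (ι (suc (length bs)) ∷ ι (length bs) ∷ sumℚ (map cost bs) ∷ ι (sum (map (spare j) (shape bs))) ∷ [])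
      (λ n′ n x y → n′ ≈ # 1 ⊕ n ⇒ n ≼ x ⊕ y ⇒ ⊢ n′ ≼ # 1 ⊕ x ⊕ y) (ι-suc (length bs))

  bins-≤-charge : (bs : List (Bin m)) → All (λ x → proj₁ x ℕ.< j × 1 ℕ.≤ proj₂ x) (shape bs) →
    ι (length bs) ≤ sumℚ (map cost bs) + ι (sum (map (spare j) (shape bs)))
  bins-≤-charge [] _ = linear [] (⊢ # 0 ≼ # 0 ⊕ # 0)
  bins-≤-charge (iso _ _ true  ∷ bs) used = count-isolated bs (bins-≤-charge bs used)
  bins-≤-charge (iso _ _ false ∷ bs) used = count-isolated bs (bins-≤-charge bs used)
  bins-≤-charge (nonIso l rs ∷ bs) ((l<j , _) ∷ used) =
    linear (ι (length (nonIso l rs ∷ bs)) ∷ ι (length bs) ∷ sumℚ (map cost bs) ∷ ι (sum (map (spare j) (shape bs))) ∷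
        cost (nonIso l rs) ∷ ι (spare j (l , length rs)) ∷ ι (sum (map (spare j) (shape (nonIso l rs ∷ bs)))) ∷ [])
      (λ n′ n x y r s y′ → n′ ≈ # 1 ⊕ n ⇒ y′ ≈ s ⊕ y ⇒ n ≼ x ⊕ y ⇒ # 1 ≼ r ⊕ s ⇒ ⊢ n′ ≼ r ⊕ x ⊕ y′)
      (ι-suc (length bs)) (ι-+ (spare j (l , length rs)) (sum (map (spare j) (shape bs))))
      (bins-≤-charge bs used) (spare-or-full l rs (ℕ.<⇒≤ l<j))

  private
    -- Whether a bin is open depends on the levels of its colours in the whole packing, so `B` stays
    -- fixed while the induction shortens `bs`.
    opened : List (Bin m) → List (Bin m) → ℕ
    opened B bs = length (filter (λ b → T? (isOpenᵇ j B b)) bs)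

    count-open : ∀ n {x y} → 1ℚ ≤ x → ι n ≤ y → ι (suc n) ≤ x + y
    count-open n {x} {y} = linear (ι n ∷ ι (suc n) ∷ x ∷ y ∷ [])
      (λ n n′ x y → n′ ≈ # 1 ⊕ n ⇒ # 1 ≼ x ⇒ n ≼ y ⇒ ⊢ n′ ≼ x ⊕ y) (ι-suc n)

    count-closed : ∀ n {x y} → 0ℚ ≤ x → ι n ≤ y → ι n ≤ x + y
    count-closed n {x} {y} = linear (ι n ∷ x ∷ y ∷ []) (λ n x y → # 0 ≼ x ⇒ n ≼ y ⇒ ⊢ n ≼ x ⊕ y)

  -- Each non-isolated bin holds a region and is charged for it, open or not. This is affordable
  -- because a colour owns at most j regions altogether.
  open-≤-charge : ∀ (B bs : List (Bin m)) → All (λ x → proj₁ x ℕ.< j × 1 ℕ.≤ proj₂ x) (shape bs) →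
    ι (opened B bs) ≤ sumℚ (map (binCharge (λ _ → 1ℚ) 1ℚ 0ℚ) bs)
  open-≤-charge B [] _ = ≤-refl
  open-≤-charge B (iso _ _ true  ∷ bs) used = count-open (opened B bs) ≤-refl (open-≤-charge B bs used)
  open-≤-charge B (iso _ _ false ∷ bs) used = count-closed (opened B bs) ≤-refl (open-≤-charge B bs used)
  open-≤-charge B (nonIso l rs ∷ bs) ((_ , nonempty) ∷ used) with isOpenᵇ j B (nonIso l rs)
  ... | true  = count-open (opened B bs) (subst (1ℚ ≤_) (sym (count≡ rs)) (ι-mono nonempty)) (open-≤-charge B bs used)
  ... | false = count-closed (opened B bs) (subst (0ℚ ≤_) (sym (count≡ rs)) (ι-≥0 (length rs))) (open-≤-charge B bs used)

module _ {m : ℕ} (c : Fin m) where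

  private
    presence : List (Bin m) → ℕ
    presence bs = length (shares c bs) ℕ.+ (length (opens c bs) ℕ.+ length (closeds c bs))

    presenceIn : Bin m → ℕ
    presenceIn b = length (sharesIn c b) ℕ.+ (length (openIn c b) ℕ.+ length (closedIn c b))

    presence-∷ : ∀ b bs → presence (b ∷ bs) ≡ presenceIn b ℕ.+ presence bs
    presence-∷ b bs rewrite length-++ (sharesIn c b) {shares c bs} | length-++ (openIn c b) {opens c bs}
      | length-++ (closedIn c b) {closeds c bs} =
      trans (cong (length (sharesIn c b) ℕ.+ length (shares c bs) ℕ.+_)
          (interchange (length (openIn c b)) (length (opens c bs)) (length (closedIn c b)) (length (closeds c bs))))
        (interchange (length (sharesIn c b)) (length (shares c bs))
          (length (openIn c b) ℕ.+ length (closedIn c b)) (length (opens c bs) ℕ.+ length (closeds c bs)))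

    contains⇒present : ∀ b → containsᵇ c b ≡ true → 1 ℕ.≤ presenceIn b
    contains⇒present (nonIso l rs) h = ℕ.≤-trans (inRegions rs h) (ℕ.m≤m+n _ 0)
      where
      inRegions : ∀ rs → any (λ r → does (proj₁ r ≟ c)) rs ≡ true → 1 ℕ.≤ length (concatMap (shareOf c l) rs)
      inRegions ((c′ , _) ∷ rs) h with does (c′ ≟ c)
      ... | true  = ℕ.s≤s ℕ.z≤n
      ... | false = inRegions rs h
    contains⇒present (iso c′ _ true)  h with does (c′ ≟ c)
    ... | true = ℕ.≤-refl
    contains⇒present (iso c′ _ false) h with does (c′ ≟ c)
    ... | true = ℕ.≤-refl

  binsWithColour-≤ : ∀ bs → binsWithColour c bs ℕ.≤
    length (shares c bs) ℕ.+ (length (opens c bs) ℕ.+ length (closeds c bs))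
  binsWithColour-≤ []       = ℕ.z≤n
  binsWithColour-≤ (b ∷ bs) = ℕ.≤-trans counted (ℕ.≤-reflexive (sym (presence-∷ b bs)))
    where
    counted : binsWithColour c (b ∷ bs) ℕ.≤ presenceIn b ℕ.+ presence bs
    counted with containsᵇ c b in eq
    ... | true  = ℕ.+-mono-≤ (contains⇒present b eq) (binsWithColour-≤ bs)
    ... | false = ℕ.≤-trans (binsWithColour-≤ bs) (ℕ.m≤n+m _ (presenceIn b))

-- The bounds for a whole run

module _ {m j : ℕ} {I : List (Item m)} {B : List (Bin m)} (valid : ValidInstance j I) (run : Run j [] I B) where

  open WellShaped (well-shaped run)

  total-bound : ∀ k → Packable k I → totalBins B ℕ.≤ 3 ℕ.* k ℕ.+ j
  total-bound k pack = ι-cancel (subst (ι (length B) ≤_) (trans (cong (_+ ι j) (sym (ι-* 3 k))) (sym (ι-+ (3 ℕ.* k) j)))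
    (linear (ι (length B) ∷ sumℚ (map cost B) ∷ ι (sum (map (spare j) (shape B))) ∷ ι j ∷ ι k ∷ sumℚ (map size I) ∷ [])
      (λ n x y j k s → n ≼ x ⊕ y ⇒ y ≼ j ⇒ x ≼ 3 · s ⇒ s ≼ k ⇒ ⊢ n ≼ 3 · k ⊕ j)
      (bins-≤-charge j B used) (ι-mono (spares-≤-levels (well-shaped run))) volume
      (packing-size I (sizes-≥0 j valid) pack)))
    where
    cost = binCharge {m} (regionSize j) 1ℚ 1ℚ
    volume : sumℚ (map cost B) ≤ ι 3 * sumℚ (map size I)
    volume = subst₂ _≤_ (sym (total-charge (regionSize j) 1ℚ 1ℚ B))
      (trans (sumF-scale 3 (λ c → classSum c (tagged (λ x → x) I)))
        (cong (ι 3 *_) (trans (classSums (tagged (λ x → x) I)) (cong sumℚ (sym (map-∘ I))))))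
      (sumF-mono λ c → subst (_≤ ι 3 * classSum c (tagged (λ x → x) I))
        (cong (capacity j (shares c B) +_) (cong₂ _+_ (sym (count≡ (opens c B))) (sym (count≡ (closeds c B)))))
        (bins-≤-size (account c valid run)))

  colour-bound : ∀ c k → Packable k (colourClass c I) → 10 ℕ.* binsWithColour c B ℕ.≤ 17 ℕ.* k ℕ.+ (30 ℕ.+ 10 ℕ.* j)
  colour-bound c k pack = ι-cancel (subst₂ _≤_ (sym (ι-* 10 (binsWithColour c B)))
    (sym (trans (ι-+ (17 ℕ.* k) (30 ℕ.+ 10 ℕ.* j)) (cong (ι (17 ℕ.* k) +_)
      (trans (ι-+ 30 (10 ℕ.* j)) (cong (ι 30 +_) (ι-* 10 j))))))
    (linear (ι (binsWithColour c B) ∷ ι (length (shares c B)) ∷ ι (length (opens c B)) ∷ ι (length (closeds c B)) ∷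
        ι j ∷ ι (17 ℕ.* k) ∷ classSum c (tagged weight I) ∷ [])
      (λ n x y z j k W → n ≼ x ⊕ (y ⊕ z) ⇒ x ≼ j ⇒ 10 · (y ⊕ z) ≼ # 30 ⊕ W ⇒ W ≼ k ⇒
        ⊢ 10 · n ≼ k ⊕ (# 30 ⊕ 10 · j))
      (subst (ι (binsWithColour c B) ≤_)
        (trans (ι-+ (length (shares c B)) _) (cong (ι (length (shares c B)) +_) (ι-+ (length (opens c B)) _)))
        (ι-mono (binsWithColour-≤ c B)))
      (ι-mono (regions-≤-level (account c valid run)))
      (isolated-≤-weight (account c valid run))
      (subst (_≤ ι (17 ℕ.* k)) (sym (classSum-tagged weight c I))
        (packing-weight (colourClass c I) (All.filter⁺ (λ e → colour e ≟ c) (sizes-≥0 j valid)) pack))))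

  open-bound : openBins j B ℕ.≤ (j ℕ.+ 2) ℕ.* m
  open-bound = ι-cancel (≤-trans (open-≤-charge j B B used)
    (subst (_≤ ι ((j ℕ.+ 2) ℕ.* m)) (sym (total-charge (λ _ → 1ℚ) 1ℚ 0ℚ B)) (sumF-≤ _ (j ℕ.+ 2) per-colour)))
    where
    per-colour : ∀ c → colourCharge (λ _ → 1ℚ) 1ℚ 0ℚ B c ≤ ι (j ℕ.+ 2)
    per-colour c = subst (_≤ ι (j ℕ.+ 2))
      (trans (ι-+ (length (shares c B)) (length (opens c B))) (cong₂ _+_ (sym (count≡ (shares c B)))
        (trans (sym (+-identityʳ _)) (cong₂ _+_ (sym (count≡ (opens c B))) (sym (sum-const 0ℚ 0 refl (closeds c B)))))))
      (ι-mono (ℕ.+-mono-≤ (regions-≤-level (account c valid run)) (open-≤2 (account c valid run))))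

theorem5 : Σ ℕ (λ C →
    (j m : ℕ) → 1 ℕ.≤ j → (I : List (Item m)) → ValidInstance j I →
    (B : List (Bin m)) → Run j [] I B →
    ((k : ℕ) → OPT I k → totalBins B ℕ.≤ 3 ℕ.* k ℕ.+ C ℕ.* j)
    × ((c : Fin m) (k : ℕ) → OPT (colourClass c I) k →
    10 ℕ.* binsWithColour c B ℕ.≤ 17 ℕ.* k ℕ.+ C ℕ.* j))
    × ((j : ℕ) → 1 ℕ.≤ j → Σ ℕ (λ D →
    (m : ℕ) (I : List (Item m)) → ValidInstance j I →
    (B : List (Bin m)) → Run j [] I B → openBins j B ℕ.≤ D ℕ.* m))
theorem5 =
  -- The colour bound has the additive term 30 + 10j, which is at most 40j for positive j.
  (40 , λ j m 1≤j I valid B run →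
    (λ k opt → ℕ.≤-trans (total-bound valid run k (proj₁ opt)) (ℕ.+-monoʳ-≤ (3 ℕ.* k) (ℕ.m≤n*m j 40))) ,
    (λ c k opt → ℕ.≤-trans (colour-bound valid run c k (proj₁ opt)) (ℕ.+-monoʳ-≤ (17 ℕ.* k) (slack 1≤j)))) ,
  (λ j 1≤j → j ℕ.+ 2 , λ m I valid B run → open-bound valid run)
  where
  slack : ∀ {j} → 1 ℕ.≤ j → 30 ℕ.+ 10 ℕ.* j ℕ.≤ 40 ℕ.* j
  slack {j} 1≤j = ℕ.≤-trans (ℕ.+-monoˡ-≤ (10 ℕ.* j) (ℕ.*-monoʳ-≤ 30 1≤j))
    (ℕ.≤-reflexive (sym (ℕ.*-distribʳ-+ j 30 10)))
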